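{- Let $r$ be a positive integer, let $F:\mathbf{Set}^r\to\mathbf{Set}$ be a decomposable $r$-sort species with composition operator $\eta$, let $\Lambda$ be a commutative ring containing $\mathbb{Q}$, and let $w$ be a $\Lambda$-weight on $(F,\eta)$. Then \[ \widetilde{\mathrm{GF}}_F(z_1,\dots,z_r,y)=\exp\big(y\,\mathrm{GF}_{F_\eta}(z_1,\dots,z_r)\big) \] and \[ \widetilde{\mathrm{GF}}_F(z_1,\dots,z_r,y)=\big(\mathrm{GF}_F(z_1,\dots,z_r)\big)^y. \]
   Context: $\mathbf{Set}$ is the category of finite sets and bijections. An object $\Omega=(\Omega^{(1)},\dots,\Omega^{(r)})$ of $\mathbf{Set}^r$ is an $r$-tuple of finite sets. Set operations on tuples are componentwise, and $\boldsymbol\emptyset=(\emptyset,\dots,\emptyset)$. An $r$-sort species is a functor $F:\mathbf{Set}^r\to\mathbf{Set}$. A composition operator for $F$ is a family of injective maps $\eta_{(\Omega_1,\Omega_2)}:F[\Omega_1]\times F[\Omega_2]\to F[\Omega_1\amalg\Omega_2]$, one for each pair with $\Omega_1\cap\Omega_2=\boldsymbol\emptyset$, with the following two properties. - Naturality: $\eta_{(\tilde\Omega_1,\tilde\Omega_2)}\circ(F[f_1]\times F[f_2])=F[f_1\amalg f_2]\circ\eta_{(\Omega_1,\Omega_2)}$ for all tuples of bijections $f_i:\Omega_i\to\tilde\Omega_i$. - Axiom (D1): whenever $\Omega_1\amalg\Omega_2=\Omega=\tilde\Omega_1\amalg\tilde\Omega_2$ (disjoint unions), \[ \eta(F[\Omega_1]\times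 F[\Omega_2])\cap\eta(F[\tilde\Omega_1]\times F[\tilde\Omega_2])=\eta(\eta(F[\Omega_{11}]\times F[\Omega_{12}])\times\eta(F[\Omega_{21}]\times F[\Omega_{22}])), \] where $\Omega_{ij}=\Omega_i\cap\tilde\Omega_j$. Here $\eta(A\times B)$ is the image under the relevant $\eta$-map. $F$ is decomposable if some $F[\Omega]\ne\emptyset$ and $F$ admits a composition operator. Define $F_\eta[\boldsymbol\emptyset]=\emptyset$ and, for $\Omega\neq\boldsymbol\emptyset$, $F_\eta[\Omega]=F[\Omega]-\bigcup\eta(F[I]\times F[J])$, the union over disjoint pairs with $I\amalg J=\Omega$ and $I\ne\boldsymbol\emptyset\ne J$. Define $F^{(0)}_\eta[\boldsymbol\emptyset]=F[\boldsymbol\emptyset]$ and $F^{(0)}_\eta[\Omega]=\emptyset$ otherwise. For $k\ge1$, define $F^{(k)}_\eta[\Omega]=\bigcup_{\Omega_1\subseteq\Omega}\eta(F_\eta[\Omega_1]\times F^{(k-1)}_\eta[\Omega-\Omega_1])$. Every $x\in F[\Omega]$ lies in exactly one $F^{(k)}_\eta[\Omega]$. A $\Lambda$-weight on $(F,\eta)$ is a family of maps $w_\Omega:F[\Omega]\to\Lambda$ satisfying: (W0) $w_{\boldsymbol\emptyset}\equiv1$ on $F[\boldsymbol\emptyset]$; (W1) $w_{\Omega_2}(F[f](x))=w_{\Omega_1}(x)$ for every morphism $f:\Omega_1\to\Omega_2$; (W2) $w(\eta(x_1,x_2))=w(x_1)w(x_2)$ for all $x_1\in F_\eta[\Omega_1]$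 and $x_2\in F[\Omega_2]$ with $\Omega_1\cap\Omega_2=\boldsymbol\emptyset$. With $[n]=\{1,\dots,n\}$: \[ \mathrm{GF}_F=\sum_{n_i\ge0}\ \sum_{x\in F[([n_1],\dots,[n_r])]}w(x)\frac{z_1^{n_1}\cdots z_r^{n_r}}{n_1!\cdots n_r!}; \] $\mathrm{GF}_{F_\eta}$ is defined in the same way with $F_\eta$ in place of $F$; and \[ \widetilde{\mathrm{GF}}_F=\sum_{n_i\ge0}\ \sum_{k\ge0}\ \sum_{x\in F^{(k)}_\eta[([n_1],\dots,[n_r])]}y^k\,w(x)\frac{z_1^{n_1}\cdots z_r^{n_r}}{n_1!\cdots n_r!}. \] -}

module Defs where

open import Level using (Level; _⊔_) renaming (suc to lsuc; zero to lzero)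
open import Data.Nat as ℕ using (ℕ; zero; suc; _<_; _≤_; _∸_; _!)
open import Data.Nat.Properties using (<-trans; n<1+n; _!≢0)
open import Data.Fin as Fin using (Fin)
open import Data.Fin.Properties using (any?)
open import Data.Bool using (Bool; true; false; not; _∧_; _∨_; if_then_else_)
open import Data.List as List using (List; []; _∷_; _++_)
open import Data.List.Relation.Unary.All as All using (All; []; _∷_)
open import Data.List.Relation.Unary.AllPairs as AllPairs using (AllPairs; []; _∷_)
open import Data.List.Membership.Propositional using (_∈_)
open import Data.Vec as Vec using (Vec; []; _∷_; lookup)
open import Data.Product using (Σ; ∃; _×_; _,_; proj₁; proj₂)
open import Data.Sum using (_⊎_; inj₁; inj₂)
open import Data.Unit using (⊤; tt)
open import Data.Integer as ℤ using (ℤ)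
open import Data.Rational as ℚ using (ℚ)
import Data.Rational.Properties as ℚP
open import Function using (_∘_; _⇔_)
open import Function.Bundles using (_↔_; Inverse)
open import Relation.Nullary using (Dec; yes; no; ¬_)
open import Relation.Nullary.Decidable using (⌊_⌋; _×-dec_; ¬?)
open import Relation.Binary.PropositionalEquality using (_≡_; refl; subst; sym)
open import Algebra.Bundles using (CommutativeRing)
open import Algebra.Morphism.Structures using (module RingMorphisms)

-- A finite set of labels (a finite subset of ℕ), represented canonically
-- by its strictly increasing list of elements.
record FinSet : Set where
  constructor mkFS
  field
    elems   : List ℕ
    .sorted : AllPairs _<_ elems

open FinSet public

Obj : ℕ → Set
Obj r = Vec FinSet r

comp : ∀ {r} → Obj r → Fin r → List ℕ
comp Ω i = elems (lookup Ω i)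

∅obj : (r : ℕ) → Obj r
∅obj r = Vec.replicate r (mkFS [] [])

isEmptyObj : ∀ {r} → Obj r → Bool
isEmptyObj [] = true
isEmptyObj (mkFS [] _ ∷ Ω) = isEmptyObj Ω
isEmptyObj (mkFS (_ ∷ _) _ ∷ Ω) = false

selL : (xs : List ℕ) → Vec Bool (List.length xs) → List ℕ
selL [] [] = []
selL (x ∷ xs) (true ∷ m) = x ∷ selL xs m
selL (x ∷ xs) (false ∷ m) = selL xs m

selL-All : ∀ {P : ℕ → Set} (xs : List ℕ) (m : Vec Bool (List.length xs)) →
           All P xs → All P (selL xs m)
selL-All [] [] [] = []
selL-All (x ∷ xs) (true ∷ m) (p ∷ ps) = p ∷ selL-All xs m ps
selL-All (x ∷ xs) (false ∷ m) (p ∷ ps) = selL-All xs m ps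

selL-sorted : (xs : List ℕ) (m : Vec Bool (List.length xs)) →
              AllPairs _<_ xs → AllPairs _<_ (selL xs m)
selL-sorted [] [] [] = []
selL-sorted (x ∷ xs) (true ∷ m) (a ∷ as) = selL-All xs m a ∷ selL-sorted xs m as
selL-sorted (x ∷ xs) (false ∷ m) (a ∷ as) = selL-sorted xs m as

selFS : (X : FinSet) → Vec Bool (List.length (elems X)) → FinSet
selFS (mkFS xs s) m = mkFS (selL xs m) (selL-sorted xs m s)

Sub : ∀ {r} → Obj r → Set
Sub [] = ⊤
Sub (X ∷ Ω) = Vec Bool (List.length (elems X)) × Sub Ω

sel : ∀ {r} (Ω : Obj r) → Sub Ω → Obj r
sel [] tt = []
sel (X ∷ Ω) (m , S) = selFS X m ∷ sel Ω S

cmp : ∀ {r} {Ω : Obj r} → Sub Ω → Sub Ω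
cmp {Ω = []} tt = tt
cmp {Ω = X ∷ Ω} (m , S) = Vec.map not m , cmp S

restrictL : (xs : List ℕ) (m t : Vec Bool (List.length xs)) →
            Vec Bool (List.length (selL xs m))
restrictL [] [] [] = []
restrictL (x ∷ xs) (true ∷ m) (b ∷ t) = b ∷ restrictL xs m t
restrictL (x ∷ xs) (false ∷ m) (b ∷ t) = restrictL xs m t

-- restrict S T : the subset Ω_S ∩ Ω_T of Ω_S (as a subset of sel Ω S)
restrict : ∀ {r} (Ω : Obj r) (S T : Sub Ω) → Sub (sel Ω S)
restrict [] tt tt = tt
restrict (mkFS xs _ ∷ Ω) (m , S) (t , T) = restrictL xs m t , restrict Ω S T

-- A morphism Ω → Ω' is a tuple of bijections Ω^(i) → Ω'^(i).  It is given
-- by label functions (only their values on Ω matter).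
record Mor {r : ℕ} (Ω Ω' : Obj r) : Set where
  field
    fun  : Fin r → ℕ → ℕ
    into : ∀ i a → a ∈ comp Ω i → fun i a ∈ comp Ω' i
    inj  : ∀ i a b → a ∈ comp Ω i → b ∈ comp Ω i → fun i a ≡ fun i b → a ≡ b
    onto : ∀ i b → b ∈ comp Ω' i → ∃ λ a → a ∈ comp Ω i × fun i a ≡ b

open Mor public

record Species (r : ℕ) : Set₁ where
  field
    F     : Obj r → Set
    size  : Obj r → ℕ
    enum  : (Ω : Obj r) → Fin (size Ω) ↔ F Ω
    fmap  : ∀ {Ω Ω'} → Mor Ω Ω' → F Ω → F Ω'
    -- functoriality (morphisms are equal when they agree on Ω)
    fmap-id : ∀ {Ω} (f : Mor Ω Ω) →
              (∀ i a → a ∈ comp Ω i → fun f i a ≡ a) →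
              ∀ x → fmap f x ≡ x
    fmap-∘  : ∀ {Ω₁ Ω₂ Ω₃} (f : Mor Ω₁ Ω₂) (g : Mor Ω₂ Ω₃) (h : Mor Ω₁ Ω₃) →
              (∀ i a → a ∈ comp Ω₁ i → fun h i a ≡ fun g i (fun f i a)) →
              ∀ x → fmap h x ≡ fmap g (fmap f x)

-- η Ω S : F[Ω_S] × F[Ω - Ω_S] → F[Ω], i.e. η_(Ω₁,Ω₂) with Ω₁ ∐ Ω₂ = Ω.
record CompOp {r : ℕ} (Sp : Species r) : Set where
  open Species Sp
  field
    η : (Ω : Obj r) (S : Sub Ω) → F (sel Ω S) → F (sel Ω (cmp S)) → F Ω
    η-injective : ∀ Ω S a b a' b' → η Ω S a b ≡ η Ω S a' b' → a ≡ a' × b ≡ b'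
    naturality : ∀ {Ω Ω'} (S : Sub Ω) (S' : Sub Ω') (f : Mor Ω Ω')
                 (f₁ : Mor (sel Ω S) (sel Ω' S'))
                 (f₂ : Mor (sel Ω (cmp S)) (sel Ω' (cmp S'))) →
                 (∀ i a → a ∈ comp (sel Ω S) i → fun f₁ i a ≡ fun f i a) →
                 (∀ i a → a ∈ comp (sel Ω (cmp S)) i → fun f₂ i a ≡ fun f i a) →
                 ∀ x y → η Ω' S' (fmap f₁ x) (fmap f₂ y) ≡ fmap f (η Ω S x y)
    D1 : ∀ Ω (S T : Sub Ω) (x : F Ω) →
         ((∃ λ a → ∃ λ b → η Ω S a b ≡ x) × (∃ λ a → ∃ λ b → η Ω T a b ≡ x))
         ⇔ (∃ λ a → ∃ λ b → ∃ λ c → ∃ λ d →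
              η Ω S (η (sel Ω S) (restrict Ω S T) a b)
                    (η (sel Ω (cmp S)) (restrict Ω (cmp S) T) c d) ≡ x)

-- F is decomposable: some F[Ω] is nonempty and F admits a composition operator
-- (the operator itself is supplied separately).
Nonempty : ∀ {r} → Species r → Set
Nonempty Sp = ∃ λ Ω → Species.F Sp Ω

module _ {r : ℕ} {Sp : Species r} (E : CompOp Sp) where
  open Species Sp
  open CompOp E

  Decomposable : (Ω : Obj r) → F Ω → Set
  Decomposable Ω x = ∃ λ (S : Sub Ω) →
    isEmptyObj (sel Ω S) ≡ false × isEmptyObj (sel Ω (cmp S)) ≡ false ×
    (∃ λ a → ∃ λ b → η Ω S a b ≡ x)

  InFη : (Ω : Obj r) → F Ω → Set
  InFη Ω x = isEmptyObj Ω ≡ false × ¬ Decomposable Ω x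

  InFk : ℕ → (Ω : Obj r) → F Ω → Set
  InFk zero Ω x = isEmptyObj Ω ≡ true
  InFk (suc k) Ω x = ∃ λ (S : Sub Ω) → ∃ λ a → ∃ λ b →
    InFη (sel Ω S) a × InFk k (sel Ω (cmp S)) b × η Ω S a b ≡ x

∃Vec? : ∀ {p} n (P : Vec Bool n → Set p) → (∀ m → Dec (P m)) → Dec (∃ P)
∃Vec? zero P P? with P? []
... | yes p = yes ([] , p)
... | no ¬p = no λ { ([] , p) → ¬p p }
∃Vec? (suc n) P P? with ∃Vec? n (λ m → P (true ∷ m)) (λ m → P? (true ∷ m))
... | yes (m , p) = yes (true ∷ m , p)
... | no ¬t with ∃Vec? n (λ m → P (false ∷ m)) (λ m → P? (false ∷ m))
...   | yes (m , p) = yes (false ∷ m , p)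
...   | no ¬f = no λ { (true ∷ m , p) → ¬t (m , p) ; (false ∷ m , p) → ¬f (m , p) }

∃Sub? : ∀ {p r} (Ω : Obj r) (P : Sub Ω → Set p) → (∀ S → Dec (P S)) → Dec (∃ P)
∃Sub? [] P P? with P? tt
... | yes p = yes (tt , p)
... | no ¬p = no λ { (tt , p) → ¬p p }
∃Sub? (X ∷ Ω) P P? with ∃Vec? _ (λ m → ∃ λ S → P (m , S))
                          (λ m → ∃Sub? Ω (λ S → P (m , S)) (λ S → P? (m , S)))
... | yes (m , S , p) = yes ((m , S) , p)
... | no ¬p = no λ { ((m , S) , p) → ¬p (m , S , p) }

∃Fin? : ∀ {p} {A : Set} {n} (e : Fin n ↔ A) (P : A → Set p) →
        (∀ a → Dec (P a)) → Dec (∃ P)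
∃Fin? e P P? with any? (λ i → P? (Inverse.to e i))
... | yes (i , p) = yes (Inverse.to e i , p)
... | no ¬p = no λ { (a , p) →
        ¬p (Inverse.from e a , subst P (sym (Inverse.strictlyInverseˡ e a)) p) }

decEqFin : ∀ {A : Set} {n} (e : Fin n ↔ A) (x y : A) → Dec (x ≡ y)
decEqFin e x y with Inverse.from e x Fin.≟ Inverse.from e y
... | yes p = yes (trans' (sym (Inverse.strictlyInverseˡ e x))
                   (trans' (cong' p) (Inverse.strictlyInverseˡ e y)))
  where
  trans' : ∀ {A : Set} {a b c : A} → a ≡ b → b ≡ c → a ≡ c
  trans' refl q = q
  cong' : ∀ {i j} → i ≡ j → Inverse.to e i ≡ Inverse.to e j
  cong' refl = refl
... | no ¬p = no λ { refl → ¬p refl }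

decBool : (b c : Bool) → Dec (b ≡ c)
decBool true true = yes refl
decBool true false = no λ ()
decBool false true = no λ ()
decBool false false = yes refl

module _ {r : ℕ} {Sp : Species r} (E : CompOp Sp) where
  open Species Sp
  open CompOp E

  decomposable? : ∀ Ω x → Dec (Decomposable E Ω x)
  decomposable? Ω x = ∃Sub? Ω _ λ S →
    decBool (isEmptyObj (sel Ω S)) false ×-dec
    (decBool (isEmptyObj (sel Ω (cmp S))) false ×-dec
     ∃Fin? (enum _) _ λ a → ∃Fin? (enum _) _ λ b → decEqFin (enum Ω) (η Ω S a b) x)

  inFη? : ∀ Ω x → Dec (InFη E Ω x)
  inFη? Ω x = decBool (isEmptyObj Ω) false ×-dec ¬? (decomposable? Ω x)

  inFk? : ∀ k Ω x → Dec (InFk E k Ω x)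
  inFk? zero Ω x = decBool (isEmptyObj Ω) true
  inFk? (suc k) Ω x = ∃Sub? Ω _ λ S →
    ∃Fin? (enum _) _ λ a → ∃Fin? (enum _) _ λ b →
    inFη? (sel Ω S) a ×-dec (inFk? k (sel Ω (cmp S)) b ×-dec
      decEqFin (enum Ω) (η Ω S a b) x)

rangeL : ℕ → ℕ → List ℕ
rangeL a zero = []
rangeL a (suc m) = a ∷ rangeL (suc a) m

rangeL-All : ∀ b a m → b < a → All (b <_) (rangeL a m)
rangeL-All b a zero p = []
rangeL-All b a (suc m) p = p ∷ rangeL-All b (suc a) m (<-trans p (n<1+n a))

rangeL-sorted : ∀ a m → AllPairs _<_ (rangeL a m)
rangeL-sorted a zero = []
rangeL-sorted a (suc m) = rangeL-All a (suc a) m (n<1+n a) ∷ rangeL-sorted (suc a) m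

[_] : ℕ → FinSet
[ n ] = mkFS (rangeL 1 n) (rangeL-sorted 1 n)

stdObj : ∀ {r} → Vec ℕ r → Obj r
stdObj = Vec.map [_]

invFactℚ : ℕ → ℚ
invFactℚ n = (ℤ.+ 1 ℚ./ (n !)) {{n !≢0}}

logCoeffℚ : ℕ → ℚ
logCoeffℚ zero = ℚ.0ℚ
logCoeffℚ (suc j) = sgn j ℚ./ suc j
  where
  sgn : ℕ → ℤ
  sgn zero = ℤ.+ 1
  sgn (suc zero) = ℤ.- (ℤ.+ 1)
  sgn (suc (suc n)) = sgn n

below : ∀ {r} → Vec ℕ r → List (Vec ℕ r)
below [] = [] ∷ []
below (n ∷ ns) = List.concatMap (λ k → List.map (k ∷_) (below ns)) (List.upTo (suc n))

totalDeg : ∀ {r} → Vec ℕ r → ℕ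
totalDeg = Vec.foldr _ ℕ._+_ 0

isZeroIdx : ∀ {r} → Vec ℕ r → Bool
isZeroIdx [] = true
isZeroIdx (zero ∷ ns) = isZeroIdx ns
isZeroIdx (suc _ ∷ ns) = false

module PowerSeries {c ℓ} (Λ : CommutativeRing c ℓ) (φ : ℚ → CommutativeRing.Carrier Λ)
                   (r : ℕ) where
  open CommutativeRing Λ

  -- formal power series in z₁,…,z_r: coefficient of z^n
  Series : Set c
  Series = Vec ℕ r → Carrier

  -- formal power series in z₁,…,z_r, y: coefficient of z^n y^k
  Series₂ : Set c
  Series₂ = Vec ℕ r → ℕ → Carrier

  sumL : List Carrier → Carrier
  sumL = List.foldr _+_ 0#

  sumFin : ∀ n → (Fin n → Carrier) → Carrier
  sumFin zero f = 0#
  sumFin (suc n) f = f Fin.zero + sumFin n (f ∘ Fin.suc)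

  oneS : Series
  oneS n = if isZeroIdx n then 1# else 0#

  _-S_ : Series → Series → Series
  (A -S B) n = A n - B n

  _*S_ : Series → Series → Series
  (A *S B) n = sumL (List.map (λ m → A m * B (Vec.zipWith _∸_ n m)) (below n))

  _^S_ : Series → ℕ → Series
  A ^S zero = oneS
  A ^S suc k = A *S (A ^S k)

  invFact : Vec ℕ r → Carrier
  invFact n = Vec.foldr _ (λ k acc → φ (invFactℚ k) * acc) 1# n

  -- exp(y·B) = Σ_k y^k B^k / k!
  expY : Series → Series₂
  expY B n k = φ (invFactℚ k) * (B ^S k) n

  -- log A = Σ_{j ≥ 1} (-1)^(j+1) (A - 1)^j / j   (for A with constant term 1;
  -- only j ≤ |n| can contribute to the coefficient of z^n)
  logS : Series → Series
  logS A n = sumL (List.map (λ j → φ (logCoeffℚ j) * ((A -S oneS) ^S j) n)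
                            (List.upTo (suc (totalDeg n))))

  powY : Series → Series₂
  powY A = expY (logS A)

  _≈S₂_ : Series₂ → Series₂ → Set ℓ
  A ≈S₂ B = ∀ n k → A n k ≈ B n k

ContainsℚVia : ∀ {c ℓ} (Λ : CommutativeRing c ℓ) → (ℚ → CommutativeRing.Carrier Λ) → Set ℓ
ContainsℚVia Λ φ = RingMorphisms.IsRingMonomorphism
  (CommutativeRing.rawRing ℚP.+-*-commutativeRing) (CommutativeRing.rawRing Λ) φ

record Weight {c ℓ} {r : ℕ} {Sp : Species r} (E : CompOp Sp)
              (Λ : CommutativeRing c ℓ) : Set (c ⊔ ℓ) where
  open Species Sp
  open CompOp E
  open CommutativeRing Λ
  field
    w  : (Ω : Obj r) → F Ω → Carrier
    W0 : ∀ x → w (∅obj r) x ≈ 1#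
    W1 : ∀ {Ω Ω'} (f : Mor Ω Ω') x → w Ω' (fmap f x) ≈ w Ω x
    W2 : ∀ Ω S a b → InFη E (sel Ω S) a → w Ω (η Ω S a b) ≈ w (sel Ω S) a * w (sel Ω (cmp S)) b

module _ {c ℓ} {r : ℕ} {Sp : Species r} {E : CompOp Sp}
         {Λ : CommutativeRing c ℓ} (φ : ℚ → CommutativeRing.Carrier Λ)
         (W : Weight E Λ) where
  open Species Sp
  open CommutativeRing Λ
  open PowerSeries Λ φ r
  open Weight W

  weightSum : (Ω : Obj r) (P : F Ω → Set) → (∀ x → Dec (P x)) → Carrier
  weightSum Ω P P? = sumFin (size Ω) λ i →
    if ⌊ P? (Inverse.to (enum Ω) i) ⌋ then w Ω (Inverse.to (enum Ω) i) else 0#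

  GF : Series
  GF n = weightSum (stdObj n) (λ _ → ⊤) (λ _ → yes tt) * invFact n

  GFη : Series
  GFη n = weightSum (stdObj n) (InFη E (stdObj n)) (inFη? E (stdObj n)) * invFact n

  GF~ : Series₂
  GF~ n k = weightSum (stdObj n) (InFk E k (stdObj n)) (inFk? E k (stdObj n)) * invFact n

{-# OPTIONS --safe #-}

-- For x ∈ F[Ω] let L(x) be the set of subsets S ⊆ Ω with x in the image of η over S ∐ (Ω − S).
-- A counting argument shows that F[∅] is a singleton, so ∅ and Ω belong to L(x); axiom (D1) and
-- the injectivity of η then make L(x) a Boolean algebra, and for x = η(a,b) over S the algebras
-- L(a) and L(b) are the restrictions of L(x) to S and to Ω − S.  Hence a ∈ F_η exactly when S is
-- an atom of L(x), removing an atom lowers the number of atoms by one, and x ∈ F^(k) exactly when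
-- L(x) has k atoms.  Counting the pairs (x, atom of L(x)) gives
--   (k+1) GF~_{k+1} = GF_{F_η} · GF~_k,  that is  GF~_k = GF_{F_η}^k / k!.
-- Summing over k, GF_F = exp GF_{F_η}, and log (exp B) = B follows by applying the Euler operator
-- θ: with A = exp B, θ(log A) = A⁻¹ θA = θB.
module Submission where

open import Defs
open import Data.Nat as ℕ using (ℕ; zero; suc; _≤_; _<_; _∸_; _!; z≤n; s≤s)
import Data.Nat.Properties as ℕP
open import Data.Fin as Fin using (Fin)
import Data.Fin.Properties as FinP
open import Data.Bool using (Bool; true; false; not; _∧_; if_then_else_)
import Data.Bool.Properties as BoolP
open import Data.Integer as ℤ using (ℤ)
import Data.Integer.Properties as ℤP
open import Data.Rational as ℚ using (ℚ; toℚᵘ)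
import Data.Rational.Properties as ℚP
open import Data.Rational.Unnormalised using (mkℚᵘ; *≡*)
import Data.Rational.Unnormalised.Properties as ℚᵘP
open import Data.List as List using (List; []; _∷_; _++_)
import Data.List.Properties as ListP
open import Data.List.Relation.Unary.Any using (here; there)
open import Data.List.Relation.Unary.All as All using ([]; _∷_)
open import Data.List.Relation.Unary.AllPairs as AllPairs using (AllPairs; []; _∷_)
open import Data.List.Relation.Unary.Unique.Propositional using (Unique)
import Data.List.Relation.Unary.Unique.Propositional.Properties as Unique
open import Data.List.Membership.Propositional using (_∈_; _∉_)
open import Data.List.Membership.Propositional.Properties using (∈-map⁺; ∈-map⁻; ∈-++⁺ˡ; ∈-++⁺ʳ; ∈-cartesianProduct⁺; ∈-cartesianProduct⁻; ∈-allFin; ∈-filter⁺; ∈-filter⁻)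
open import Data.List.Membership.Propositional.Properties.WithK using (unique∧set⇒bag)
open import Data.List.Relation.Binary.BagAndSetEquality using (∼bag⇒↭)
open import Data.List.Relation.Binary.Permutation.Propositional as Perm using (_↭_)
open import Data.List.Relation.Binary.Permutation.Propositional.Properties using (↭-length)
open import Data.Vec as Vec using (Vec; []; _∷_)
import Data.Vec.Properties as VecP
open import Data.Product using (∃; _×_; _,_; proj₁; proj₂)
open import Data.Sum using (_⊎_; inj₁; inj₂; [_,_]′)
open import Data.Empty using (⊥; ⊥-elim)
open import Data.Unit using (⊤; tt)
open import Function using (_∘_; mk⇔)
open import Function.Bundles using (_↔_; Inverse; Equivalence)
open import Relation.Nullary using (Dec; yes; no; ¬_; recompute)
open import Relation.Nullary.Decidable using (⌊_⌋; _×-dec_)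
open import Relation.Binary.PropositionalEquality as ≡ using (_≡_; _≢_)
open import Algebra.Bundles using (CommutativeRing)
open import Algebra.Morphism.Structures using (module RingMorphisms)
import Algebra.Properties.AbelianGroup as AbelianGroupProperties
import Algebra.Properties.CommutativeSemigroup as CommutativeSemigroupProperties
import Algebra.Properties.Ring as RingProperties
import Relation.Binary.Reasoning.Setoid as SetoidReasoning

-- The type of η depends on the subset it is taken over, so a subset, its complement and their
-- common refinements with another subset are objects of different types. Describing subsets by
-- predicates on labels lets one predicate be evaluated on all of them, and (D1) becomes a statement
-- about a single predicate. Finiteness of F[Ω] enters twice. Over ∅, η embeds F[∅] × F[∅] into
-- F[∅], which leaves at most one structure there. With that structure fixed as one factor, η
-- becomes an injective self-map of F[Ω], hence onto. So trivial splittings always exist, and a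
-- splitting of one factor can be extended by the empty set to a splitting of the whole. The number
-- of atoms makes k independent of the order of peeling, so every atom of x in F^(k+1) can be
-- removed first and leaves an element of F^(k). The removed factor stands on the left and lies in
-- F_η, which is the case covered by (W2). On the analytic side every infinite sum is replaced by a
-- truncation whose error has high order. Division by k + 1 and by the total degree uses ℚ inside Λ.

module Labels where
  open ≡ using (refl; sym; trans; cong; cong₂; subst)

  -- Subsets of an object are handled as predicates on labels: restricting such a subset to a
  -- smaller object, or intersecting two of them, then needs no reindexing.
  LabelPred : ℕ → Set
  LabelPred r = Fin r → ℕ → Bool

  -- Subsets of an object cut out by label predicates.

  bitsL : (xs : List ℕ) → (ℕ → Bool) → Vec Bool (List.length xs)
  bitsL [] p = []
  bitsL (x ∷ xs) p = p x ∷ bitsL xs p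

  bits : ∀ {r} (Ω : Obj r) → LabelPred r → Sub Ω
  bits [] p = tt
  bits (X ∷ Ω) p = bitsL (elems X) (p Fin.zero) , bits Ω (p ∘ Fin.suc)

  ∈-selL-bitsL⁻ : ∀ xs p {a} → a ∈ selL xs (bitsL xs p) → a ∈ xs × p a ≡ true
  ∈-selL-bitsL⁻ (x ∷ xs) p a∈ with p x in eq
  ∈-selL-bitsL⁻ (x ∷ xs) p (here refl) | true = here refl , eq
  ∈-selL-bitsL⁻ (x ∷ xs) p (there a∈) | true =
    let a∈xs , pa = ∈-selL-bitsL⁻ xs p a∈ in there a∈xs , pa
  ∈-selL-bitsL⁻ (x ∷ xs) p a∈ | false =
    let a∈xs , pa = ∈-selL-bitsL⁻ xs p a∈ in there a∈xs , pa

  ∈-selL-bitsL⁺ : ∀ xs p {a} → a ∈ xs → p a ≡ true → a ∈ selL xs (bitsL xs p)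
  ∈-selL-bitsL⁺ (x ∷ xs) p (here refl) pa rewrite pa = here refl
  ∈-selL-bitsL⁺ (x ∷ xs) p (there a∈) pa with p x
  ... | true = there (∈-selL-bitsL⁺ xs p a∈ pa)
  ... | false = ∈-selL-bitsL⁺ xs p a∈ pa

  ∈-sel-bits⁻ : ∀ {r} (Ω : Obj r) p i {a} → a ∈ comp (sel Ω (bits Ω p)) i →
                a ∈ comp Ω i × p i a ≡ true
  ∈-sel-bits⁻ (X ∷ Ω) p Fin.zero = ∈-selL-bitsL⁻ (elems X) (p Fin.zero)
  ∈-sel-bits⁻ (X ∷ Ω) p (Fin.suc i) = ∈-sel-bits⁻ Ω (p ∘ Fin.suc) i

  ∈-sel-bits⁺ : ∀ {r} (Ω : Obj r) p i {a} → a ∈ comp Ω i → p i a ≡ true →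
                a ∈ comp (sel Ω (bits Ω p)) i
  ∈-sel-bits⁺ (X ∷ Ω) p Fin.zero = ∈-selL-bitsL⁺ (elems X) (p Fin.zero)
  ∈-sel-bits⁺ (X ∷ Ω) p (Fin.suc i) = ∈-sel-bits⁺ Ω (p ∘ Fin.suc) i

  ∁ : ∀ {r} → LabelPred r → LabelPred r
  ∁ p i a = not (p i a)

  map-not-bitsL : ∀ xs p → Vec.map not (bitsL xs p) ≡ bitsL xs (not ∘ p)
  map-not-bitsL [] p = refl
  map-not-bitsL (x ∷ xs) p = cong (not (p x) ∷_) (map-not-bitsL xs p)

  cmp-bits : ∀ {r} (Ω : Obj r) p → cmp {Ω = Ω} (bits Ω p) ≡ bits Ω (∁ p)
  cmp-bits [] p = refl
  cmp-bits (X ∷ Ω) p = cong₂ _,_ (map-not-bitsL (elems X) _) (cmp-bits Ω _)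

  ∈-sel-cmp⁻ : ∀ {r} (Ω : Obj r) p i {a} → a ∈ comp (sel Ω (cmp {Ω = Ω} (bits Ω p))) i →
               a ∈ comp Ω i × p i a ≡ false
  ∈-sel-cmp⁻ Ω p i a∈ rewrite cmp-bits Ω p =
    let a∈Ω , ¬pa = ∈-sel-bits⁻ Ω (∁ p) i a∈ in a∈Ω , BoolP.not-injective ¬pa

  ∈-sel-cmp⁺ : ∀ {r} (Ω : Obj r) p i {a} → a ∈ comp Ω i → p i a ≡ false →
               a ∈ comp (sel Ω (cmp {Ω = Ω} (bits Ω p))) i
  ∈-sel-cmp⁺ Ω p i a∈ ¬pa rewrite cmp-bits Ω p = ∈-sel-bits⁺ Ω (∁ p) i a∈ (cong not ¬pa)

  restrictL-bitsL : ∀ xs m p → restrictL xs m (bitsL xs p) ≡ bitsL (selL xs m) p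
  restrictL-bitsL [] [] p = refl
  restrictL-bitsL (x ∷ xs) (true ∷ m) p = cong (p x ∷_) (restrictL-bitsL xs m p)
  restrictL-bitsL (x ∷ xs) (false ∷ m) p = restrictL-bitsL xs m p

  restrict-bits : ∀ {r} (Ω : Obj r) S p → restrict Ω S (bits Ω p) ≡ bits (sel Ω S) p
  restrict-bits [] tt p = refl
  restrict-bits (X ∷ Ω) (m , S) p =
    cong₂ _,_ (restrictL-bitsL (elems X) m _) (restrict-bits Ω S _)

  bitsL-cong : ∀ xs {p q} → (∀ a → a ∈ xs → p a ≡ q a) → bitsL xs p ≡ bitsL xs q
  bitsL-cong [] e = refl
  bitsL-cong (x ∷ xs) e =
    cong₂ _∷_ (e x (here refl)) (bitsL-cong xs (λ a a∈ → e a (there a∈)))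

  bits-cong : ∀ {r} (Ω : Obj r) {p q} → (∀ i a → a ∈ comp Ω i → p i a ≡ q i a) →
              bits Ω p ≡ bits Ω q
  bits-cong [] e = refl
  bits-cong (X ∷ Ω) e =
    cong₂ _,_ (bitsL-cong (elems X) (e Fin.zero)) (bits-cong Ω (e ∘ Fin.suc))

  bitsL-injective : ∀ xs {p q} → bitsL xs p ≡ bitsL xs q → ∀ a → a ∈ xs → p a ≡ q a
  bitsL-injective (x ∷ xs) e a (here refl) = VecP.∷-injectiveˡ e
  bitsL-injective (x ∷ xs) e a (there a∈) = bitsL-injective xs (VecP.∷-injectiveʳ e) a a∈

  bits-injective : ∀ {r} (Ω : Obj r) {p q} → bits Ω p ≡ bits Ω q →
                   ∀ i a → a ∈ comp Ω i → p i a ≡ q i a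
  bits-injective (X ∷ Ω) e Fin.zero = bitsL-injective (elems X) (cong proj₁ e)
  bits-injective (X ∷ Ω) e (Fin.suc i) = bits-injective Ω (cong proj₂ e) i

  -- The field `sorted` is irrelevant and cannot be projected; since sortedness is decidable, a
  -- usable proof is recomputed.
  elems-sorted : (X : FinSet) → AllPairs _<_ (elems X)
  elems-sorted (mkFS xs s) = recompute (AllPairs.allPairs? ℕ._<?_ xs) s

  memL : (xs : List ℕ) → Vec Bool (List.length xs) → ℕ → Bool
  memL [] [] a = false
  memL (x ∷ xs) (b ∷ m) a = if ⌊ a ℕ.≟ x ⌋ then b else memL xs m a

  -- Strict sorting makes the labels distinct, so looking up a label cannot stop at an earlier
  -- position. With repeated labels a mask need not come from any predicate.
  bitsL-memL : ∀ xs → AllPairs _<_ xs → ∀ m → bitsL xs (memL xs m) ≡ m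
  bitsL-memL [] s [] = refl
  bitsL-memL (x ∷ xs) (x< ∷ s) (b ∷ m) =
    cong₂ _∷_ head (trans (bitsL-cong xs tail) (bitsL-memL xs s m))
    where
    head : memL (x ∷ xs) (b ∷ m) x ≡ b
    head with x ℕ.≟ x
    ... | yes _ = refl
    ... | no x≢x = ⊥-elim (x≢x refl)
    tail : ∀ a → a ∈ xs → memL (x ∷ xs) (b ∷ m) a ≡ memL xs m a
    tail a a∈ with a ℕ.≟ x
    ... | yes refl = ⊥-elim (ℕP.<-irrefl refl (All.lookup x< a∈))
    ... | no _ = refl

  mem : ∀ {r} (Ω : Obj r) → Sub Ω → LabelPred r
  mem (X ∷ Ω) (m , S) Fin.zero = memL (elems X) m
  mem (X ∷ Ω) (m , S) (Fin.suc i) = mem Ω S i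

  bits-mem : ∀ {r} (Ω : Obj r) S → bits Ω (mem Ω S) ≡ S
  bits-mem [] tt = refl
  bits-mem (X ∷ Ω) (m , S) = cong₂ _,_ (bitsL-memL (elems X) (elems-sorted X) m) (bits-mem Ω S)

  ∈-sel⁻ : ∀ {r} (Ω : Obj r) S i {a} → a ∈ comp (sel Ω S) i → a ∈ comp Ω i
  ∈-sel⁻ Ω S i a∈ =
    proj₁ (∈-sel-bits⁻ Ω (mem Ω S) i (subst (λ T → _ ∈ comp (sel Ω T) i) (sym (bits-mem Ω S)) a∈))

  IsEmpty : ∀ {r} → Obj r → Set
  IsEmpty Ω = ∀ i a → a ∉ comp Ω i

  isEmptyObj-true⁻ : ∀ {r} (Ω : Obj r) → isEmptyObj Ω ≡ true → IsEmpty Ω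
  isEmptyObj-true⁻ (mkFS [] _ ∷ Ω) e Fin.zero a ()
  isEmptyObj-true⁻ (mkFS [] _ ∷ Ω) e (Fin.suc i) = isEmptyObj-true⁻ Ω e i

  isEmptyObj-true⁺ : ∀ {r} (Ω : Obj r) → IsEmpty Ω → isEmptyObj Ω ≡ true
  isEmptyObj-true⁺ [] e = refl
  isEmptyObj-true⁺ (mkFS [] _ ∷ Ω) e = isEmptyObj-true⁺ Ω (e ∘ Fin.suc)
  isEmptyObj-true⁺ (mkFS (x ∷ _) _ ∷ Ω) e = ⊥-elim (e Fin.zero x (here refl))

  isEmptyObj-false⁺ : ∀ {r} (Ω : Obj r) → ¬ IsEmpty Ω → isEmptyObj Ω ≡ false
  isEmptyObj-false⁺ Ω ne with isEmptyObj Ω in eq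
  ... | true = ⊥-elim (ne (isEmptyObj-true⁻ Ω eq))
  ... | false = refl

  isEmptyObj-false⁻ : ∀ {r} (Ω : Obj r) → isEmptyObj Ω ≡ false → ¬ IsEmpty Ω
  isEmptyObj-false⁻ Ω e em with () ← trans (sym e) (isEmptyObj-true⁺ Ω em)

  isEmpty? : ∀ {r} (Ω : Obj r) → Dec (IsEmpty Ω)
  isEmpty? Ω with isEmptyObj Ω in eq
  ... | true = yes (isEmptyObj-true⁻ Ω eq)
  ... | false = no (isEmptyObj-false⁻ Ω eq)

  -- Bijections between objects, and objects of equal sizes.

  record Iso {r} (Ω Ω' : Obj r) : Set where
    field
      to from : Fin r → ℕ → ℕ
      to-∈    : ∀ i a → a ∈ comp Ω i → to i a ∈ comp Ω' i
      from-∈  : ∀ i b → b ∈ comp Ω' i → from i b ∈ comp Ω i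
      from-to : ∀ i a → a ∈ comp Ω i → from i (to i a) ≡ a
      to-from : ∀ i b → b ∈ comp Ω' i → to i (from i b) ≡ b

  open Iso

  iso-sym : ∀ {r} {Ω Ω' : Obj r} → Iso Ω Ω' → Iso Ω' Ω
  iso-sym f = record
    { to = from f ; from = to f ; to-∈ = from-∈ f ; from-∈ = to-∈ f
    ; from-to = to-from f ; to-from = from-to f }

  iso-refl : ∀ {r} {Ω : Obj r} → Iso Ω Ω
  iso-refl = record
    { to = λ _ a → a ; from = λ _ a → a ; to-∈ = λ _ _ a∈ → a∈ ; from-∈ = λ _ _ a∈ → a∈
    ; from-to = λ _ _ _ → refl ; to-from = λ _ _ _ → refl }

  iso-mor : ∀ {r} {Ω Ω' : Obj r} → Iso Ω Ω' → Mor Ω Ω'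
  iso-mor f = record
    { fun = to f
    ; into = to-∈ f
    ; inj = λ i a b a∈ b∈ e →
        trans (sym (from-to f i a a∈)) (trans (cong (from f i) e) (from-to f i b b∈))
    ; onto = λ i b b∈ → from f i b , from-∈ f i b b∈ , to-from f i b b∈
    }

  iso-restrict : ∀ {r} {Ω Ω' Θ Θ' : Obj r} (f : Iso Ω Ω') →
                 (∀ i a → a ∈ comp Θ i → a ∈ comp Ω i × to f i a ∈ comp Θ' i) →
                 (∀ i b → b ∈ comp Θ' i → b ∈ comp Ω' i × from f i b ∈ comp Θ i) → Iso Θ Θ'
  iso-restrict f h k = record
    { to = to f ; from = from f
    ; to-∈ = λ i a a∈ → proj₂ (h i a a∈)
    ; from-∈ = λ i b b∈ → proj₂ (k i b b∈)
    ; from-to = λ i a a∈ → from-to f i a (proj₁ (h i a a∈))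
    ; to-from = λ i b b∈ → to-from f i b (proj₁ (k i b b∈)) }

  -- The image under `f` of the subset described by `p`: a predicate moves forward by composing with
  -- the inverse. This is why `Iso` carries the inverse as a label function, where `Mor` has only
  -- surjectivity.
  pullback : ∀ {r} {Ω Ω' : Obj r} → Iso Ω Ω' → LabelPred r → LabelPred r
  pullback f p i b = p i (from f i b)

  iso-sel : ∀ {r} {Ω Ω' : Obj r} (f : Iso Ω Ω') p →
            Iso (sel Ω (bits Ω p)) (sel Ω' (bits Ω' (pullback f p)))
  iso-sel {Ω = Ω} {Ω'} f p = iso-restrict f
    (λ i a a∈ → let a∈Ω , pa = ∈-sel-bits⁻ Ω p i a∈ in
       a∈Ω , ∈-sel-bits⁺ Ω' _ i (to-∈ f i a a∈Ω) (trans (cong (p i) (from-to f i a a∈Ω)) pa))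
    (λ i b b∈ → let b∈Ω' , pb = ∈-sel-bits⁻ Ω' _ i b∈ in
       b∈Ω' , ∈-sel-bits⁺ Ω p i (from-∈ f i b b∈Ω') pb)

  iso-sel-cmp : ∀ {r} {Ω Ω' : Obj r} (f : Iso Ω Ω') p →
                Iso (sel Ω (cmp {Ω = Ω} (bits Ω p)))
                    (sel Ω' (cmp {Ω = Ω'} (bits Ω' (pullback f p))))
  iso-sel-cmp {Ω = Ω} {Ω'} f p = iso-restrict f
    (λ i a a∈ → let a∈Ω , pa = ∈-sel-cmp⁻ Ω p i a∈ in
       a∈Ω , ∈-sel-cmp⁺ Ω' _ i (to-∈ f i a a∈Ω) (trans (cong (p i) (from-to f i a a∈Ω)) pa))
    (λ i b b∈ → let b∈Ω' , pb = ∈-sel-cmp⁻ Ω' _ i b∈ in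
       b∈Ω' , ∈-sel-cmp⁺ Ω p i (from-∈ f i b b∈Ω') pb)

  -- Sends the label at a position of the first list to the label at the same position of the
  -- second. The last clause is a filler for labels outside the first list.
  matchL : List ℕ → List ℕ → ℕ → ℕ
  matchL (x ∷ xs) (y ∷ ys) a = if ⌊ a ℕ.≟ x ⌋ then y else matchL xs ys a
  matchL _ _ a = a

  matchL-∈ : ∀ xs ys → List.length xs ≡ List.length ys →
             ∀ a → a ∈ xs → matchL xs ys a ∈ ys
  matchL-∈ (x ∷ xs) (y ∷ ys) e a a∈ with a ℕ.≟ x
  ... | yes _ = here refl
  matchL-∈ (x ∷ xs) (y ∷ ys) e a (here a≡x) | no a≢x = ⊥-elim (a≢x a≡x)
  matchL-∈ (x ∷ xs) (y ∷ ys) e a (there a∈) | no a≢x =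
    there (matchL-∈ xs ys (ℕP.suc-injective e) a a∈)

  matchL-inverse : ∀ xs ys → AllPairs _<_ xs → AllPairs _<_ ys →
                   List.length xs ≡ List.length ys →
                   ∀ a → a ∈ xs → matchL ys xs (matchL xs ys a) ≡ a
  matchL-inverse (x ∷ xs) (y ∷ ys) (x< ∷ sx) (y< ∷ sy) e a a∈ with a ℕ.≟ x
  matchL-inverse (x ∷ xs) (y ∷ ys) (x< ∷ sx) (y< ∷ sy) e a a∈ | yes a≡x with y ℕ.≟ y
  ... | yes _ = sym a≡x
  ... | no y≢y = ⊥-elim (y≢y refl)
  matchL-inverse (x ∷ xs) (y ∷ ys) (x< ∷ sx) (y< ∷ sy) e a (here a≡x) | no a≢x = ⊥-elim (a≢x a≡x)
  matchL-inverse (x ∷ xs) (y ∷ ys) (x< ∷ sx) (y< ∷ sy) e a (there a∈) | no a≢x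
    with matchL xs ys a ℕ.≟ y
  ... | yes m≡y = ⊥-elim (ℕP.<-irrefl (sym m≡y)
                    (All.lookup y< (matchL-∈ xs ys (ℕP.suc-injective e) a a∈)))
  ... | no _ = matchL-inverse xs ys sx sy (ℕP.suc-injective e) a a∈

  -- Sizes of objects and of their parts.

  sizes : ∀ {r} → Obj r → Vec ℕ r
  sizes = Vec.map (List.length ∘ elems)

  sameSizes⇒iso : ∀ {r} {Ω Ω' : Obj r} → sizes Ω ≡ sizes Ω' → Iso Ω Ω'
  sameSizes⇒iso {Ω = Ω} {Ω'} e = record
    { to = λ i → matchL (comp Ω i) (comp Ω' i)
    ; from = λ i → matchL (comp Ω' i) (comp Ω i)
    ; to-∈ = λ i → matchL-∈ _ _ (len i)
    ; from-∈ = λ i → matchL-∈ _ _ (sym (len i))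
    ; from-to = λ i → matchL-inverse (comp Ω i) (comp Ω' i)
        (elems-sorted (Vec.lookup Ω i)) (elems-sorted (Vec.lookup Ω' i)) (len i)
    ; to-from = λ i → matchL-inverse (comp Ω' i) (comp Ω i)
        (elems-sorted (Vec.lookup Ω' i)) (elems-sorted (Vec.lookup Ω i)) (sym (len i)) }
    where
    len : ∀ i → List.length (comp Ω i) ≡ List.length (comp Ω' i)
    len i = trans (sym (VecP.lookup-map i _ Ω))
              (trans (cong (λ v → Vec.lookup v i) e) (VecP.lookup-map i _ Ω'))

  isEmpty⇒iso : ∀ {r} {Ω Ω' : Obj r} → IsEmpty Ω → IsEmpty Ω' → Iso Ω Ω'
  isEmpty⇒iso e e' = record
    { to = λ _ a → a ; from = λ _ a → a
    ; to-∈ = λ i a a∈ → ⊥-elim (e i a a∈)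
    ; from-∈ = λ i a a∈ → ⊥-elim (e' i a a∈)
    ; from-to = λ _ _ _ → refl ; to-from = λ _ _ _ → refl }

  length-rangeL : ∀ a n → List.length (rangeL a n) ≡ n
  length-rangeL a zero = refl
  length-rangeL a (suc n) = cong suc (length-rangeL (suc a) n)

  sizes-stdObj : ∀ {r} (n : Vec ℕ r) → sizes (stdObj n) ≡ n
  sizes-stdObj [] = refl
  sizes-stdObj (n ∷ ns) = cong₂ _∷_ (length-rangeL 1 n) (sizes-stdObj ns)

  double : ℕ → ℕ
  double zero = zero
  double (suc n) = suc (suc (double n))

  -- Taking every other label cuts an object of doubled sizes into two parts of sizes n, so that two
  -- disjoint copies of a given object fit into one. Alternation, unlike first half against second
  -- half, keeps both size computations structural in n.
  alternate : ∀ a n → Vec Bool (List.length (rangeL a (double n)))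
  alternate a zero = []
  alternate a (suc n) = true ∷ false ∷ alternate (suc (suc a)) n

  alternateObj : ∀ {r} (n : Vec ℕ r) → Sub (stdObj (Vec.map double n))
  alternateObj [] = tt
  alternateObj (n ∷ ns) = alternate 1 n , alternateObj ns

  length-alternate : ∀ a n → List.length (selL (rangeL a (double n)) (alternate a n)) ≡ n
  length-alternate a zero = refl
  length-alternate a (suc n) = cong suc (length-alternate (suc (suc a)) n)

  length-alternate-not : ∀ a n →
    List.length (selL (rangeL a (double n)) (Vec.map not (alternate a n))) ≡ n
  length-alternate-not a zero = refl
  length-alternate-not a (suc n) = cong suc (length-alternate-not (suc (suc a)) n)

  sizes-alternate : ∀ {r} (n : Vec ℕ r) → sizes (sel _ (alternateObj n)) ≡ n
  sizes-alternate [] = refl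
  sizes-alternate (n ∷ ns) = cong₂ _∷_ (length-alternate 1 n) (sizes-alternate ns)

  sizes-alternate-cmp : ∀ {r} (n : Vec ℕ r) →
    sizes (sel _ (cmp {Ω = stdObj (Vec.map double n)} (alternateObj n))) ≡ n
  sizes-alternate-cmp [] = refl
  sizes-alternate-cmp (n ∷ ns) = cong₂ _∷_ (length-alternate-not 1 n) (sizes-alternate-cmp ns)

  length-selL : ∀ xs m →
    List.length xs ≡ List.length (selL xs m) ℕ.+ List.length (selL xs (Vec.map not m))
  length-selL [] [] = refl
  length-selL (x ∷ xs) (true ∷ m) = cong suc (length-selL xs m)
  length-selL (x ∷ xs) (false ∷ m) =
    trans (cong suc (length-selL xs m)) (sym (ℕP.+-suc (List.length (selL xs m)) _))

  sizes-sel : ∀ {r} (Ω : Obj r) S →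
    sizes Ω ≡ Vec.zipWith ℕ._+_ (sizes (sel Ω S)) (sizes (sel Ω (cmp {Ω = Ω} S)))
  sizes-sel [] tt = refl
  sizes-sel (X ∷ Ω) (m , S) = cong₂ _∷_ (length-selL (elems X) m) (sizes-sel Ω S)

  totalDeg-+ : ∀ {r} (m n : Vec ℕ r) → totalDeg (Vec.zipWith ℕ._+_ m n) ≡ totalDeg m ℕ.+ totalDeg n
  totalDeg-+ [] [] = refl
  totalDeg-+ (a ∷ m) (b ∷ n) rewrite totalDeg-+ m n = +-interchange a b (totalDeg m) (totalDeg n)
    where
    open CommutativeSemigroupProperties ℕP.+-commutativeSemigroup
      using () renaming (interchange to +-interchange)

  card : ∀ {r} → Obj r → ℕ
  card Ω = totalDeg (sizes Ω)

  card-sel : ∀ {r} (Ω : Obj r) S → card Ω ≡ card (sel Ω S) ℕ.+ card (sel Ω (cmp {Ω = Ω} S))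
  card-sel Ω S = trans (cong totalDeg (sizes-sel Ω S)) (totalDeg-+ (sizes (sel Ω S)) _)

  card-positive : ∀ {r} (Ω : Obj r) → isEmptyObj Ω ≡ false → 1 ≤ card Ω
  card-positive (mkFS [] _ ∷ Ω) e = card-positive Ω e
  card-positive (mkFS (_ ∷ _) _ ∷ Ω) e = s≤s z≤n

  isEmptyObj-stdObj : ∀ {r} (n : Vec ℕ r) → isEmptyObj (stdObj n) ≡ isZeroIdx n
  isEmptyObj-stdObj [] = refl
  isEmptyObj-stdObj (zero ∷ n) = isEmptyObj-stdObj n
  isEmptyObj-stdObj (suc _ ∷ n) = refl

  ∅obj-empty : ∀ r → isEmptyObj (∅obj r) ≡ true
  ∅obj-empty zero = refl
  ∅obj-empty (suc r) = ∅obj-empty r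

open Labels

-- Finite sets as duplicate-free lists, and counting arguments.

module Enumerations where
  open ≡ using (refl; sym; trans; cong; cong₂; subst)

  -- In a duplicate-free list each membership has at most one proof, so having the same members
  -- already means equal multiplicities. All bijective comparisons of sums and counts below go
  -- through this.
  unique-↭ : ∀ {a} {A : Set a} {xs ys : List A} → Unique xs → Unique ys →
             (∀ {z} → z ∈ xs → z ∈ ys) → (∀ {z} → z ∈ ys → z ∈ xs) → xs ↭ ys
  unique-↭ u v f g = ∼bag⇒↭ (unique∧set⇒bag u v (mk⇔ f g))

  module _ {A : Set} {n : ℕ} (e : Fin n ↔ A) where

    from-injective : ∀ {x y} → Inverse.from e x ≡ Inverse.from e y → x ≡ y
    from-injective {x} {y} eq = trans (sym (Inverse.strictlyInverseˡ e x))
      (trans (cong (Inverse.to e) eq) (Inverse.strictlyInverseˡ e y))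

    to-injective : ∀ {i j} → Inverse.to e i ≡ Inverse.to e j → i ≡ j
    to-injective {i} {j} eq = trans (sym (Inverse.strictlyInverseʳ e i))
      (trans (cong (Inverse.from e) eq) (Inverse.strictlyInverseʳ e j))

    elements : List A
    elements = List.map (Inverse.to e) (List.allFin n)

    elements-unique : Unique elements
    elements-unique = Unique.map⁺ to-injective (Unique.allFin⁺ n)

    ∈-elements : ∀ x → x ∈ elements
    ∈-elements x = subst (_∈ elements) (Inverse.strictlyInverseˡ e x)
      (∈-map⁺ (Inverse.to e) (∈-allFin (Inverse.from e x)))

  -- If `j` were missed, punching it out of the codomain would give an injection into a strictly
  -- smaller `Fin`.
  fin-injective⇒surjective : ∀ {n} (f : Fin n → Fin n) → (∀ {i j} → f i ≡ f j → i ≡ j) →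
                             ∀ j → ∃ λ i → f i ≡ j
  fin-injective⇒surjective {suc n} f inj j with FinP.any? (λ i → f i Fin.≟ j)
  ... | yes hit = hit
  ... | no miss = ⊥-elim (ℕP.1+n≰n (FinP.injective⇒≤ {f = λ i → Fin.punchOut (avoids i)}
                    (λ {i} {k} eq → inj (FinP.punchOut-injective (avoids i) (avoids k) eq))))
    where
    avoids : ∀ i → j ≢ f i
    avoids i j≡fi = miss (i , sym j≡fi)

  finite-injective⇒surjective : ∀ {A : Set} {n} (e : Fin n ↔ A) (g : A → A) →
    (∀ {x y} → g x ≡ g y → x ≡ y) → ∀ x → ∃ λ y → g y ≡ x
  finite-injective⇒surjective e g inj x
    with i , eq ← fin-injective⇒surjective (Inverse.from e ∘ g ∘ Inverse.to e)
                    (to-injective e ∘ inj ∘ from-injective e) (Inverse.from e x)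
    = Inverse.to e i , from-injective e eq

  -- An injection of A × A into A gives N · N ≤ N for the number N of elements, which fails once N ≥
  -- 2.
  pairing⇒subsingleton : ∀ {A : Set} {n} (e : Fin n ↔ A) (g : A → A → A) →
    (∀ {x y x' y'} → g x y ≡ g x' y' → x ≡ x' × y ≡ y') → ∀ (x y : A) → x ≡ y
  pairing⇒subsingleton {n = zero} e g inj x y with () ← Inverse.from e x
  pairing⇒subsingleton {n = suc zero} e g inj x y = from-injective e (unique₁ _ _)
    where
    unique₁ : (i j : Fin 1) → i ≡ j
    unique₁ Fin.zero Fin.zero = refl
  pairing⇒subsingleton {n = suc (suc n)} e g inj x y =
    ⊥-elim (ℕP.<⇒≱ n<n*n (FinP.injective⇒≤ h-injective))
    where
    N = suc (suc n)
    h : Fin (N ℕ.* N) → Fin N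
    h k = Inverse.from e (g (Inverse.to e (proj₁ (Fin.remQuot {N} N k)))
                            (Inverse.to e (proj₂ (Fin.remQuot {N} N k))))
    h-injective : ∀ {k l} → h k ≡ h l → k ≡ l
    h-injective {k} {l} eq with e₁ , e₂ ← inj (from-injective e eq) =
      trans (sym (FinP.combine-remQuot {N} N k))
        (trans (cong₂ Fin.combine (to-injective e e₁) (to-injective e e₂))
               (FinP.combine-remQuot {N} N l))
    n<n*n : N < N ℕ.* N
    n<n*n = ℕP.m<m*n N N (s≤s (s≤s z≤n))

  allVec : ∀ n → List (Vec Bool n)
  allVec zero = [] ∷ []
  allVec (suc n) = List.map (true ∷_) (allVec n) ++ List.map (false ∷_) (allVec n)

  ∈-allVec : ∀ {n} (v : Vec Bool n) → v ∈ allVec n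
  ∈-allVec [] = here refl
  ∈-allVec (true ∷ v) = ∈-++⁺ˡ (∈-map⁺ (true ∷_) (∈-allVec v))
  ∈-allVec {suc n} (false ∷ v) = ∈-++⁺ʳ (List.map (true ∷_) (allVec n)) (∈-map⁺ (false ∷_) (∈-allVec v))

  allVec-unique : ∀ n → Unique (allVec n)
  allVec-unique zero = [] ∷ []
  allVec-unique (suc n) = Unique.++⁺
    (Unique.map⁺ VecP.∷-injectiveʳ (allVec-unique n))
    (Unique.map⁺ VecP.∷-injectiveʳ (allVec-unique n))
    λ (v∈ , v∈') → disjoint (∈-map⁻ (true ∷_) v∈) (∈-map⁻ (false ∷_) v∈')
    where
    disjoint : ∀ {v : Vec Bool (suc n)} →
               (∃ λ u → u ∈ allVec n × v ≡ true ∷ u) → (∃ λ u → u ∈ allVec n × v ≡ false ∷ u) → ⊥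
    disjoint (_ , _ , refl) (_ , _ , ())

  allSub : ∀ {r} (Ω : Obj r) → List (Sub Ω)
  allSub [] = tt ∷ []
  allSub (X ∷ Ω) = List.cartesianProduct (allVec _) (allSub Ω)

  ∈-allSub : ∀ {r} (Ω : Obj r) S → S ∈ allSub Ω
  ∈-allSub [] tt = here refl
  ∈-allSub (X ∷ Ω) (m , S) = ∈-cartesianProduct⁺ (∈-allVec m) (∈-allSub Ω S)

  allSub-unique : ∀ {r} (Ω : Obj r) → Unique (allSub Ω)
  allSub-unique [] = [] ∷ []
  allSub-unique (X ∷ Ω) = Unique.cartesianProduct⁺ (allVec-unique _) (allSub-unique Ω)

open Enumerations

-- Splittings of a structure and the algebra L(x).

module Splittings where
  open ≡ using (refl; sym; trans; cong; cong₂; subst)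

  open Iso

  On : ∀ {r} → Obj r → LabelPred r → Bool → Set
  On Ω p b = ∀ i a → a ∈ comp Ω i → p i a ≡ b

  _∩_ : ∀ {r} → LabelPred r → LabelPred r → LabelPred r
  (p ∩ q) i a = p i a ∧ q i a

  -- Reduces an arbitrary subset to one given by a predicate. Everything whose type mentions `S` has
  -- to be part of the motive `P`, since η and its factors are typed over `S`.
  ∀bits : ∀ {r} (Ω : Obj r) {ℓ} (P : Sub Ω → Set ℓ) → (∀ p → P (bits Ω p)) → ∀ S → P S
  ∀bits Ω P h S = subst P (bits-mem Ω S) (h (mem Ω S))

  sel-bits-empty : ∀ {r} (Ω : Obj r) p → IsEmpty (sel Ω (bits Ω p)) → On Ω p false
  sel-bits-empty Ω p e i a a∈ = BoolP.¬-not (e i a ∘ ∈-sel-bits⁺ Ω p i a∈)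

  sel-cmp-empty : ∀ {r} (Ω : Obj r) p → IsEmpty (sel Ω (cmp {Ω = Ω} (bits Ω p))) → On Ω p true
  sel-cmp-empty Ω p e i a a∈ = BoolP.¬-not (e i a ∘ ∈-sel-cmp⁺ Ω p i a∈)

  empty-sel-bits : ∀ {r} (Ω : Obj r) p → On Ω p false → IsEmpty (sel Ω (bits Ω p))
  empty-sel-bits Ω p h i a a∈ with a∈Ω , pa ← ∈-sel-bits⁻ Ω p i a∈
    with () ← trans (sym (h i a a∈Ω)) pa

  empty-sel-cmp : ∀ {r} (Ω : Obj r) p → On Ω p true → IsEmpty (sel Ω (cmp {Ω = Ω} (bits Ω p)))
  empty-sel-cmp Ω p h i a a∈ with a∈Ω , pa ← ∈-sel-cmp⁻ Ω p i a∈
    with () ← trans (sym (h i a a∈Ω)) pa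

  full-iso : ∀ {r} (Ω : Obj r) p → On Ω p true → Iso Ω (sel Ω (bits Ω p))
  full-iso Ω p h = iso-restrict (iso-refl {Ω = Ω})
    (λ i a a∈ → a∈ , ∈-sel-bits⁺ Ω p i a∈ (h i a a∈))
    (λ i a a∈ → let a∈Ω = ∈-sel⁻ Ω _ i a∈ in a∈Ω , a∈Ω)

  full-iso-cmp : ∀ {r} (Ω : Obj r) p → On Ω p false → Iso Ω (sel Ω (cmp {Ω = Ω} (bits Ω p)))
  full-iso-cmp Ω p h = iso-restrict (iso-refl {Ω = Ω})
    (λ i a a∈ → a∈ , ∈-sel-cmp⁺ Ω p i a∈ (h i a a∈))
    (λ i a a∈ → let a∈Ω = ∈-sel⁻ Ω _ i a∈ in a∈Ω , a∈Ω)

  module Splitting {r : ℕ} {Sp : Species r} (E : CompOp Sp) where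
    open Species Sp
    open CompOp E

    transport : ∀ {Ω Ω'} → Iso Ω Ω' → F Ω → F Ω'
    transport f = fmap (iso-mor f)

    transport-inverse : ∀ {Ω Ω'} (f : Iso Ω Ω') x → transport (iso-sym f) (transport f x) ≡ x
    transport-inverse f x = trans
      (sym (fmap-∘ (iso-mor f) (iso-mor (iso-sym f)) (iso-mor iso-refl)
                   (λ i a a∈ → sym (from-to f i a a∈)) x))
      (fmap-id (iso-mor iso-refl) (λ _ _ _ → refl) x)

    transport-injective : ∀ {Ω Ω'} (f : Iso Ω Ω') {x y} → transport f x ≡ transport f y → x ≡ y
    transport-injective f {x} {y} e = trans (sym (transport-inverse f x))
      (trans (cong (transport (iso-sym f)) e) (transport-inverse f y))

    SplitsAt : ∀ Ω → F Ω → Sub Ω → Set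
    SplitsAt Ω x S = ∃ λ a → ∃ λ b → η Ω S a b ≡ x

    Splits : ∀ Ω → F Ω → LabelPred r → Set
    Splits Ω x p = SplitsAt Ω x (bits Ω p)

    splits-cong : ∀ Ω x {p q} → (∀ i a → a ∈ comp Ω i → p i a ≡ q i a) →
                  Splits Ω x p → Splits Ω x q
    splits-cong Ω x e = subst (SplitsAt Ω x) (bits-cong Ω e)

    -- (D1) writes η(a,b) through four blocks over the common refinement; injectivity of η over `S`
    -- identifies the two inner composites with a and b themselves.
    splits-η⁻ : ∀ Ω S a b q → Splits Ω (η Ω S a b) q →
                Splits (sel Ω S) a q × Splits (sel Ω (cmp S)) b q
    splits-η⁻ Ω S a b q s
      with a₁ , a₂ , b₁ , b₂ , e ← Equivalence.to (D1 Ω S (bits Ω q) (η Ω S a b))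
                                     ((a , b , refl) , s)
      with ea , eb ← η-injective Ω S _ _ _ _ e
      = subst (SplitsAt _ a) (restrict-bits Ω S q) (a₁ , a₂ , ea)
      , subst (SplitsAt _ b) (restrict-bits Ω (cmp S) q) (b₁ , b₂ , eb)

    -- The converse direction of (D1): splittings of both factors by the same predicate assemble to
    -- the four-block form.
    splits-η⁺ : ∀ Ω S a b q → Splits (sel Ω S) a q → Splits (sel Ω (cmp S)) b q →
                Splits Ω (η Ω S a b) q
    splits-η⁺ Ω S a b q s t
      with a₁ , a₂ , ea ← subst (SplitsAt _ a) (sym (restrict-bits Ω S q)) s
         | b₁ , b₂ , eb ← subst (SplitsAt _ b) (sym (restrict-bits Ω (cmp S) q)) t
      = proj₂ (Equivalence.from (D1 Ω S (bits Ω q) (η Ω S a b))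
                 (a₁ , a₂ , b₁ , b₂ , cong₂ (η Ω S) ea eb))

    transport-η : ∀ {Ω Ω'} (f : Iso Ω Ω') p a b →
      η Ω' (bits Ω' (pullback f p)) (transport (iso-sel f p) a) (transport (iso-sel-cmp f p) b)
      ≡ transport f (η Ω (bits Ω p) a b)
    transport-η {Ω} {Ω'} f p a b = naturality (bits Ω p) (bits Ω' (pullback f p)) (iso-mor f)
      (iso-mor (iso-sel f p)) (iso-mor (iso-sel-cmp f p)) (λ _ _ _ → refl) (λ _ _ _ → refl) a b

    splits-transport : ∀ {Ω Ω'} (f : Iso Ω Ω') x p → Splits Ω x p →
                       Splits Ω' (transport f x) (pullback f p)
    splits-transport f x p (a , b , refl) = _ , _ , transport-η f p a b

    -- For x in F_η the algebra L(x) has only its two trivial members. Stating triviality label by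
    -- label, instead of by emptiness tests, lets it be restricted to parts and combined with other
    -- predicates.
    indecomposable⁻ : ∀ Ω x → InFη E Ω x → ∀ q → Splits Ω x q → On Ω q false ⊎ On Ω q true
    indecomposable⁻ Ω x (_ , indec) q s
      with isEmpty? (sel Ω (bits Ω q)) | isEmpty? (sel Ω (cmp (bits Ω q)))
    ... | yes e | _ = inj₁ (sel-bits-empty Ω q e)
    ... | no _ | yes e = inj₂ (sel-cmp-empty Ω q e)
    ... | no n₁ | no n₂ =
      ⊥-elim (indec (bits Ω q , isEmptyObj-false⁺ (sel Ω (bits Ω q)) n₁ ,
                     isEmptyObj-false⁺ (sel Ω (cmp (bits Ω q))) n₂ , s))

    indecomposable⁺ : ∀ Ω x → ¬ IsEmpty Ω → (∀ q → Splits Ω x q → On Ω q false ⊎ On Ω q true) →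
                      InFη E Ω x
    indecomposable⁺ Ω x ne h = isEmptyObj-false⁺ Ω ne , λ (S , n₁ , n₂ , s) →
      ∀bits Ω (λ S → isEmptyObj (sel Ω S) ≡ false → isEmptyObj (sel Ω (cmp S)) ≡ false →
                     SplitsAt Ω x S → ⊥)
        (λ p n₁ n₂ s → [ isEmptyObj-false⁻ (sel Ω (bits Ω p)) n₁ ∘ empty-sel-bits Ω p
                       , isEmptyObj-false⁻ (sel Ω (cmp (bits Ω p))) n₂ ∘ empty-sel-cmp Ω p ]′ (h p s))
        S n₁ n₂ s

    isEmpty-iso : ∀ {Ω Ω' : Obj r} → Iso Ω Ω' → IsEmpty Ω' → IsEmpty Ω
    isEmpty-iso f e i a a∈ = e i _ (to-∈ f i a a∈)

    InFη-transport : ∀ {Ω Ω'} (f : Iso Ω Ω') x → InFη E Ω x → InFη E Ω' (transport f x)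
    InFη-transport {Ω} {Ω'} f x x∈@(ne , _) =
      indecomposable⁺ Ω' _ (isEmptyObj-false⁻ Ω ne ∘ isEmpty-iso f) λ q s →
        let s' = subst (λ y → Splits Ω y (pullback (iso-sym f) q)) (transport-inverse f x)
                       (splits-transport (iso-sym f) _ q s)
        in [ inj₁ ∘ back q , inj₂ ∘ back q ]′ (indecomposable⁻ Ω x x∈ _ s')
      where
      back : ∀ q {v} → On Ω (pullback (iso-sym f) q) v → On Ω' q v
      back q h i b b∈ = trans (cong (q i) (sym (to-from f i b b∈))) (h i _ (from-∈ f i b b∈))

    InFk-transport : ∀ k {Ω Ω'} (f : Iso Ω Ω') x → InFk E k Ω x → InFk E k Ω' (transport f x)
    InFk-transport zero {Ω} {Ω'} f x e =
      isEmptyObj-true⁺ Ω' (isEmpty-iso (iso-sym f) (isEmptyObj-true⁻ Ω e))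
    InFk-transport (suc k) {Ω} {Ω'} f x (S , s) =
      ∀bits Ω (λ S → (∃ λ a → ∃ λ b → InFη E (sel Ω S) a × InFk E k (sel Ω (cmp S)) b × η Ω S a b ≡ x) →
                     InFk E (suc k) Ω' (transport f x)) step S s
      where
      step : ∀ p → (∃ λ a → ∃ λ b → InFη E (sel Ω (bits Ω p)) a ×
                      InFk E k (sel Ω (cmp (bits Ω p))) b × η Ω (bits Ω p) a b ≡ x) →
             InFk E (suc k) Ω' (transport f x)
      step p (a , b , a∈ , b∈ , refl) =
        bits Ω' (pullback f p) , _ , _ , InFη-transport (iso-sel f p) a a∈ ,
        InFk-transport k (iso-sel-cmp f p) b b∈ , transport-η f p a b

    -- Each of the k peeled pieces is nonempty. The bound makes the sum over all k a finite one in
    -- every degree.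
    InFk-card : ∀ k Ω x → InFk E k Ω x → k ≤ card Ω
    InFk-card zero Ω x _ = z≤n
    InFk-card (suc k) Ω x (S , a , b , (ne , _) , b∈ , _) =
      subst (suc k ≤_) (sym (card-sel Ω S))
        (ℕP.+-mono-≤ (card-positive (sel Ω S) ne) (InFk-card k (sel Ω (cmp S)) b b∈))

    module _ (nonempty : Nonempty Sp) where

      -- D1 for a splitting and itself yields factors over ∅; to get any splitting at all, combine
      -- two disjoint copies of an inhabited Ω₀.
      F-empty : ∀ Ω → IsEmpty Ω → F Ω
      F-empty Ω empty = transport (isEmpty⇒iso Θ-empty empty) a₂
        where
        Ω₀ = proj₁ nonempty
        x₀ = proj₂ nonempty
        n = sizes Ω₀
        Ω₂ = stdObj (Vec.map double n)
        S = alternateObj n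
        a = transport (sameSizes⇒iso {Ω = Ω₀} {sel Ω₂ S} (sym (sizes-alternate n))) x₀
        b = transport (sameSizes⇒iso {Ω = Ω₀} {sel Ω₂ (cmp S)} (sym (sizes-alternate-cmp n))) x₀
        p = mem Ω₂ S
        s : Splits (sel Ω₂ S) a p
        s = proj₁ (splits-η⁻ Ω₂ S a b p (subst (SplitsAt Ω₂ (η Ω₂ S a b)) (sym (bits-mem Ω₂ S))
                                                (a , b , refl)))
        Θ = sel (sel Ω₂ S) (cmp (bits (sel Ω₂ S) p))
        a₂ : F Θ
        a₂ = proj₁ (proj₂ s)
        p-on-S : On (sel Ω₂ S) p true
        p-on-S i c c∈ = proj₂ (∈-sel-bits⁻ Ω₂ p i
          (subst (λ T → c ∈ comp (sel Ω₂ T) i) (sym (bits-mem Ω₂ S)) c∈))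
        Θ-empty : IsEmpty Θ
        Θ-empty = empty-sel-cmp (sel Ω₂ S) p p-on-S

      -- Both parts of an empty object are again empty, so after relabelling the factors η is an
      -- injection of F[Ω] × F[Ω] into F[Ω].
      F-empty-unique : ∀ Ω → IsEmpty Ω → (x y : F Ω) → x ≡ y
      F-empty-unique Ω empty = pairing⇒subsingleton (enum Ω)
        (λ x y → η Ω S (transport f x) (transport g y))
        (λ e → let e₁ , e₂ = η-injective Ω S _ _ _ _ e in
               transport-injective f e₁ , transport-injective g e₂)
        where
        S = bits Ω (λ _ _ → true)
        f : Iso Ω (sel Ω S)
        f = isEmpty⇒iso empty (λ i a → empty i a ∘ ∈-sel⁻ Ω S i)
        g : Iso Ω (sel Ω (cmp S))
        g = isEmpty⇒iso empty (λ i a → empty i a ∘ ∈-sel⁻ Ω (cmp S) i)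

      -- With the structure over the empty complement fixed and Ω identified with its full subset, η
      -- becomes an injective self-map of the finite set F[Ω]. It is therefore onto and reaches x.
      splits-full : ∀ Ω x p → On Ω p true → Splits Ω x p
      splits-full Ω x p h =
        let f = full-iso Ω p h
            unit = F-empty _ (empty-sel-cmp Ω p h)
            _ , e = finite-injective⇒surjective (enum Ω)
              (λ y → η Ω (bits Ω p) (transport f y) unit)
              (λ eq → transport-injective f (proj₁ (η-injective Ω _ _ _ _ _ eq))) x
        in _ , _ , e

      splits-empty : ∀ Ω x p → On Ω p false → Splits Ω x p
      splits-empty Ω x p h =
        let f = full-iso-cmp Ω p h
            unit = F-empty _ (empty-sel-bits Ω p h)
            _ , e = finite-injective⇒surjective (enum Ω)
              (λ y → η Ω (bits Ω p) unit (transport f y))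
              (λ eq → transport-injective f (proj₂ (η-injective Ω _ _ _ _ _ eq))) x
        in _ , _ , e

      -- The meet `p ∩ q` is `q` on the left part and empty on the right part. The empty predicate
      -- splits every structure, so a splitting of the left factor alone is enough.
      splits-left : ∀ Ω p a b q → Splits (sel Ω (bits Ω p)) a q →
                    Splits Ω (η Ω (bits Ω p) a b) (p ∩ q)
      splits-left Ω p a b q s = splits-η⁺ Ω (bits Ω p) a b (p ∩ q)
        (splits-cong _ a (λ i c c∈ → sym (cong (_∧ q i c) (proj₂ (∈-sel-bits⁻ Ω p i c∈)))) s)
        (splits-empty _ b (p ∩ q) λ i c c∈ → cong (_∧ q i c) (proj₂ (∈-sel-cmp⁻ Ω p i c∈)))

      splits-right : ∀ Ω p a b q → Splits (sel Ω (cmp (bits Ω p))) b q →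
                     Splits Ω (η Ω (bits Ω p) a b) (∁ p ∩ q)
      splits-right Ω p a b q s = splits-η⁺ Ω (bits Ω p) a b (∁ p ∩ q)
        (splits-empty _ a (∁ p ∩ q) λ i c c∈ → cong (λ v → not v ∧ q i c) (proj₂ (∈-sel-bits⁻ Ω p i c∈)))
        (splits-cong _ b (λ i c c∈ → sym (cong (λ v → not v ∧ q i c) (proj₂ (∈-sel-cmp⁻ Ω p i c∈)))) s)

      -- Atoms of L(x), and the effect of removing one.

      Atom : ∀ Ω → F Ω → Sub Ω → Set
      Atom Ω x S = ∃ λ a → ∃ λ b → InFη E (sel Ω S) a × η Ω S a b ≡ x

      atom? : ∀ Ω x S → Dec (Atom Ω x S)
      atom? Ω x S = ∃Fin? (enum _) _ λ a → ∃Fin? (enum _) _ λ b →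
        inFη? E (sel Ω S) a ×-dec decEqFin (enum Ω) (η Ω S a b) x

      -- The q with Splits Ω x q form a Boolean algebra; MinimalSplit describes its atoms.
      record MinimalSplit (Ω : Obj r) (x : F Ω) (p : LabelPred r) : Set where
        field
          splits   : Splits Ω x p
          nonzero  : ¬ On Ω p false
          minimal  : ∀ q → Splits Ω x q →
                     On (sel Ω (bits Ω p)) q false ⊎ On (sel Ω (bits Ω p)) q true

      open MinimalSplit

      -- Every q in L(x) restricts to a splitting of the factor a, and those are trivial because a
      -- is in F_η.
      atom⇒minimal : ∀ Ω x p → Atom Ω x (bits Ω p) → MinimalSplit Ω x p
      atom⇒minimal Ω x p (a , b , a∈ , refl) = record
        { splits = a , b , refl
        ; nonzero = isEmptyObj-false⁻ (sel Ω (bits Ω p)) (proj₁ a∈) ∘ empty-sel-bits Ω p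
        ; minimal = λ q s →
            indecomposable⁻ _ a a∈ q (proj₁ (splits-η⁻ Ω (bits Ω p) a b q s)) }

      -- A splitting q of the left factor gives `p ∩ q` in L(x), and minimality of p forces it to be
      -- trivial on the part cut out by p.
      minimal⇒atom : ∀ Ω x p → MinimalSplit Ω x p → Atom Ω x (bits Ω p)
      minimal⇒atom Ω x p m with splits m | minimal m
      ... | a , b , refl | min = a , b ,
        indecomposable⁺ _ a (nonzero m ∘ sel-bits-empty Ω p)
          (λ q s → [ inj₁ ∘ drop q , inj₂ ∘ drop q ]′ (min (p ∩ q) (splits-left Ω p a b q s))) ,
        refl
        where
        drop : ∀ q {v} → On (sel Ω (bits Ω p)) (p ∩ q) v → On (sel Ω (bits Ω p)) q v
        drop q h i c c∈ =
          trans (sym (cong (_∧ q i c) (proj₂ (∈-sel-bits⁻ Ω p i c∈)))) (h i c c∈)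

      atoms : ∀ Ω → F Ω → List (Sub Ω)
      atoms Ω x = List.filter (atom? Ω x) (allSub Ω)

      atomCount : ∀ Ω → F Ω → ℕ
      atomCount Ω x = List.length (atoms Ω x)

      module _ (Ω : Obj r) (p : LabelPred r) (a : F (sel Ω (bits Ω p)))
               (b : F (sel Ω (cmp (bits Ω p)))) where
        private
          x : F Ω
          x = η Ω (bits Ω p) a b
          Θ : Obj r
          Θ = sel Ω (cmp (bits Ω p))

        -- A subset of the complement read as a subset of Ω. The meet with `∁ p` gives it the form
        -- in which `splits-right` delivers splittings.
        extend : Sub Θ → Sub Ω
        extend U = bits Ω (∁ p ∩ mem Θ U)

        extend-injective : ∀ {U V} → extend U ≡ extend V → U ≡ V
        extend-injective {U} {V} e = trans (sym (bits-mem Θ U)) (trans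
          (bits-cong Θ λ i c c∈ → let c∈Ω , pc = ∈-sel-cmp⁻ Ω p i c∈ in
            trans (sym (cong (λ v → not v ∧ mem Θ U i c) pc))
              (trans (bits-injective Ω e i c c∈Ω) (cong (λ v → not v ∧ mem Θ V i c) pc)))
          (bits-mem Θ V))

        minimal-extend : ∀ u → MinimalSplit Θ b u → MinimalSplit Ω x (∁ p ∩ u)
        minimal-extend u m = record
          { splits = splits-right Ω p a b u (splits m)
          ; nonzero = λ h → nonzero m λ i c c∈ → let c∈Ω , pc = ∈-sel-cmp⁻ Ω p i c∈ in
              trans (sym (cong (λ v → not v ∧ u i c) pc)) (h i c c∈Ω)
          ; minimal = λ q s → [ inj₁ ∘ enlarge q , inj₂ ∘ enlarge q ]′
              (minimal m q (proj₂ (splits-η⁻ Ω (bits Ω p) a b q s))) }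
          where
          enlarge : ∀ q {v} → On (sel Θ (bits Θ u)) q v → On (sel Ω (bits Ω (∁ p ∩ u))) q v
          enlarge q h i c c∈ with c∈Ω , puc ← ∈-sel-bits⁻ Ω (∁ p ∩ u) i c∈ | p i c in pc
          ... | false = h i c (∈-sel-bits⁺ Θ u i (∈-sel-cmp⁺ Ω p i c∈Ω pc)
                                puc)
          ... | true with () ← puc

        -- Being disjoint from p, the subset t lies in the complement, so nothing is lost on
        -- restriction. A splitting of b is tested against t after extension by the empty set over
        -- p.
        minimal-restrict : ∀ t → MinimalSplit Ω x t →
          On Ω (t ∩ p) false → MinimalSplit Θ b t
        minimal-restrict t m disj = record
          { splits = proj₂ (splits-η⁻ Ω (bits Ω p) a b t (splits m))
          ; nonzero = λ h → nonzero m λ i c c∈ → outside h i c c∈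
          ; minimal = λ q s → [ inj₁ ∘ shrink q , inj₂ ∘ shrink q ]′
              (minimal m (∁ p ∩ q) (splits-right Ω p a b q s)) }
          where
          outside : On Θ t false → On Ω t false
          outside h i c c∈ with p i c in pc
          ... | false = h i c (∈-sel-cmp⁺ Ω p i c∈ pc)
          ... | true = trans (sym (BoolP.∧-identityʳ (t i c)))
                         (subst (λ v → t i c ∧ v ≡ false) pc (disj i c c∈))
          shrink : ∀ q {v} → On (sel Ω (bits Ω t)) (∁ p ∩ q) v → On (sel Θ (bits Θ t)) q v
          shrink q h i c c∈ =
            let c∈Θ , tc = ∈-sel-bits⁻ Θ t i c∈
                c∈Ω , pc = ∈-sel-cmp⁻ Ω p i c∈Θ
            in trans (sym (cong (λ v → not v ∧ q i c) pc)) (h i c (∈-sel-bits⁺ Ω t i c∈Ω tc))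

        -- Two atoms are equal or disjoint: each is tested by the minimality of the other.
        minimal-dichotomy : ∀ t → MinimalSplit Ω x p → MinimalSplit Ω x t →
          bits Ω t ≡ bits Ω p ⊎ On Ω (t ∩ p) false
        minimal-dichotomy t mp mt with minimal mt p (splits mp) | minimal mp t (splits mt)
        ... | inj₁ h | _ = inj₂ disjoint
          where
          disjoint : On Ω (t ∩ p) false
          disjoint i c c∈ with t i c in tc
          ... | false = refl
          ... | true = h i c (∈-sel-bits⁺ Ω t i c∈ tc)
        -- Here t lies inside p and yet vanishes on p, so it would be the zero element.
        ... | inj₂ t⊆p | inj₁ h = ⊥-elim (nonzero mt zero-t)
          where
          zero-t : On Ω t false
          zero-t i c c∈ with t i c in tc
          ... | false = refl
          ... | true = trans (sym tc)
            (h i c (∈-sel-bits⁺ Ω p i c∈ (t⊆p i c (∈-sel-bits⁺ Ω t i c∈ tc))))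
        ... | inj₂ t⊆p | inj₂ p⊆t = inj₁ (bits-cong Ω agree)
          where
          agree : ∀ i c → c ∈ comp Ω i → t i c ≡ p i c
          agree i c c∈ with t i c in tc | p i c in pc
          ... | true | true = refl
          ... | false | false = refl
          ... | true | false = trans (sym (t⊆p i c (∈-sel-bits⁺ Ω t i c∈ tc))) pc
          ... | false | true = trans (sym tc) (p⊆t i c (∈-sel-bits⁺ Ω p i c∈ pc))

        -- By the dichotomy an atom other than p avoids p and comes from an atom of L(b); conversely
        -- each atom of L(b) extends to one of L(x).
        atoms-η : InFη E (sel Ω (bits Ω p)) a →
                  atoms Ω x ↭ bits Ω p ∷ List.map extend (atoms Θ b)
        atoms-η a∈ = unique-↭
          (Unique.filter⁺ (atom? Ω x) (allSub-unique Ω))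
          (All.tabulate (λ {T} T∈ → fresh T (∈-map⁻ extend T∈)) ∷
           Unique.map⁺ extend-injective (Unique.filter⁺ (atom? Θ b) (allSub-unique Θ)))
          (λ {T} T∈ → ∀bits Ω (λ T → Atom Ω x T → T ∈ bits Ω p ∷ List.map extend (atoms Θ b))
                        forward T (proj₂ (∈-filter⁻ (atom? Ω x) {xs = allSub Ω} T∈)))
          backward
          where
          p-minimal : MinimalSplit Ω x p
          p-minimal = atom⇒minimal Ω x p (a , b , a∈ , refl)
          minimal-of : ∀ U → U ∈ atoms Θ b → MinimalSplit Θ b (mem Θ U)
          minimal-of U U∈ = atom⇒minimal Θ b (mem Θ U) (subst (Atom Θ b) (sym (bits-mem Θ U))
            (proj₂ (∈-filter⁻ (atom? Θ b) {xs = allSub Θ} U∈)))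
          -- p is false on the complement, so an extended atom equal to p would come from the zero
          -- element of L(b).
          fresh : ∀ T → (∃ λ U → U ∈ atoms Θ b × T ≡ extend U) → bits Ω p ≢ T
          fresh T (U , U∈ , refl) e = nonzero (minimal-of U U∈) λ i c c∈ →
            let c∈Ω , pc = ∈-sel-cmp⁻ Ω p i c∈
            in trans (sym (cong (λ v → not v ∧ mem Θ U i c) pc))
                     (trans (sym (bits-injective Ω e i c c∈Ω)) pc)
          forward : ∀ t → Atom Ω x (bits Ω t) → bits Ω t ∈ bits Ω p ∷ List.map extend (atoms Θ b)
          forward t at with minimal-dichotomy t p-minimal (atom⇒minimal Ω x t at)
          ... | inj₁ e = here e
          ... | inj₂ disj = there (subst (_∈ List.map extend (atoms Θ b)) same
                  (∈-map⁺ extend (∈-filter⁺ (atom? Θ b) (∈-allSub Θ _)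
                    (minimal⇒atom Θ b t (minimal-restrict t (atom⇒minimal Ω x t at) disj)))))
            where
            same : extend (bits Θ t) ≡ bits Ω t
            same = bits-cong Ω agree
              where
              agree : ∀ i c → c ∈ comp Ω i → (∁ p ∩ mem Θ (bits Θ t)) i c ≡ t i c
              agree i c c∈ with p i c in pc
              ... | false = bits-injective Θ (bits-mem Θ (bits Θ t)) i c (∈-sel-cmp⁺ Ω p i c∈ pc)
              ... | true = sym (trans (sym (BoolP.∧-identityʳ (t i c)))
                                 (subst (λ v → t i c ∧ v ≡ false) pc (disj i c c∈)))
          backward : ∀ {T} → T ∈ bits Ω p ∷ List.map extend (atoms Θ b) → T ∈ atoms Ω x
          backward (here refl) = ∈-filter⁺ (atom? Ω x) (∈-allSub Ω _) (a , b , a∈ , refl)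
          backward (there T∈) with U , U∈ , refl ← ∈-map⁻ extend T∈ =
            ∈-filter⁺ (atom? Ω x) (∈-allSub Ω _)
              (minimal⇒atom Ω x _ (minimal-extend (mem Θ U) (minimal-of U U∈)))

      atomCount-η : ∀ Ω S a b → InFη E (sel Ω S) a →
                    atomCount Ω (η Ω S a b) ≡ suc (atomCount (sel Ω (cmp S)) b)
      atomCount-η Ω = ∀bits Ω
        (λ S → ∀ a b → InFη E (sel Ω S) a →
               atomCount Ω (η Ω S a b) ≡ suc (atomCount (sel Ω (cmp S)) b))
        λ p a b a∈ → trans (↭-length (atoms-η Ω p a b a∈))
                           (cong suc (ListP.length-map (extend Ω p a b) (atoms (sel Ω (cmp (bits Ω p))) b)))

      -- Induction on |Ω|: an atom of the left factor of a proper splitting is an atom of the whole.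
      atom-exists : ∀ n Ω → card Ω ≤ n → ¬ IsEmpty Ω → (x : F Ω) → ∃ λ p → MinimalSplit Ω x p
      atom-exists n Ω c≤n ne x with decomposable? E Ω x
      ... | no indec = (λ _ _ → true) , record
        { splits = splits-full Ω x _ (λ _ _ _ → refl)
        ; nonzero = λ h → ne λ i a a∈ → true≢false (h i a a∈)
        ; minimal = λ q s → [ inj₁ ∘ narrow q , inj₂ ∘ narrow q ]′
            (indecomposable⁻ Ω x (isEmptyObj-false⁺ Ω ne , indec) q s) }
        where
        true≢false : true ≢ false
        true≢false ()
        narrow : ∀ q {v} → On Ω q v → On (sel Ω (bits Ω (λ _ _ → true))) q v
        narrow q h i a a∈ = h i a (∈-sel⁻ Ω _ i a∈)
      atom-exists zero Ω c≤n ne x | yes _ =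
        ⊥-elim (ℕP.<⇒≱ (card-positive Ω (isEmptyObj-false⁺ Ω ne)) c≤n)
      atom-exists (suc n) Ω c≤n ne x | yes (S , n₁ , n₂ , s) =
        ∀bits Ω (λ S → isEmptyObj (sel Ω S) ≡ false → isEmptyObj (sel Ω (cmp S)) ≡ false →
                       SplitsAt Ω x S → ∃ λ p → MinimalSplit Ω x p) step S n₁ n₂ s
        where
        step : ∀ p → isEmptyObj (sel Ω (bits Ω p)) ≡ false →
               isEmptyObj (sel Ω (cmp (bits Ω p))) ≡ false →
               Splits Ω x p → ∃ λ p → MinimalSplit Ω x p
        step p n₁ n₂ (a , b , refl) =
          let u , m = atom-exists n (sel Ω (bits Ω p)) smaller (isEmptyObj-false⁻ (sel Ω (bits Ω p)) n₁) a in
          p ∩ u , record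
            { splits = splits-left Ω p a b u (splits m)
            ; nonzero = λ h → nonzero m λ i c c∈ →
                let c∈Ω , pc = ∈-sel-bits⁻ Ω p i c∈ in
                trans (sym (cong (_∧ u i c) pc)) (h i c c∈Ω)
            ; minimal = λ q s → [ inj₁ ∘ enlarge u q , inj₂ ∘ enlarge u q ]′
                (minimal m q (proj₁ (splits-η⁻ Ω (bits Ω p) a b q s))) }
          where
          smaller : card (sel Ω (bits Ω p)) ≤ n
          smaller = ℕP.≤-pred (ℕP.≤-trans
            (subst (suc (card (sel Ω (bits Ω p))) ≤_) (sym (card-sel Ω (bits Ω p)))
              (subst (_≤ card (sel Ω (bits Ω p)) ℕ.+ card (sel Ω (cmp (bits Ω p))))
                (ℕP.+-comm (card (sel Ω (bits Ω p))) 1)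
                (ℕP.+-monoʳ-≤ (card (sel Ω (bits Ω p))) (card-positive (sel Ω (cmp (bits Ω p))) n₂)))) c≤n)
          enlarge : ∀ u q {v} → On (sel (sel Ω (bits Ω p)) (bits (sel Ω (bits Ω p)) u)) q v →
                    On (sel Ω (bits Ω (p ∩ u))) q v
          enlarge u q h i c c∈ with c∈Ω , puc ← ∈-sel-bits⁻ Ω (p ∩ u) i c∈ | p i c in pc
          ... | true = h i c (∈-sel-bits⁺ (sel Ω (bits Ω p)) u i (∈-sel-bits⁺ Ω p i c∈Ω pc)
                               puc)
          ... | false with () ← puc

      -- Every peeling removes exactly one atom, so k is determined by x, whatever the order of
      -- peeling.
      InFk⇒atomCount : ∀ k Ω x → InFk E k Ω x → atomCount Ω x ≡ k
      InFk⇒atomCount zero Ω x e with atoms Ω x in eq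
      ... | [] = refl
      ... | S ∷ _ with a , b , (ne , _) , _ ←
              proj₂ (∈-filter⁻ (atom? Ω x) {v = S} {xs = allSub Ω}
                      (subst (S ∈_) (sym eq) (here refl)))
            = ⊥-elim (isEmptyObj-false⁻ (sel Ω S) ne λ i c c∈ →
                isEmptyObj-true⁻ Ω e i c (∈-sel⁻ Ω S i c∈))
      InFk⇒atomCount (suc k) Ω x (S , a , b , a∈ , b∈ , refl) =
        trans (atomCount-η Ω S a b a∈) (cong suc (InFk⇒atomCount k (sel Ω (cmp S)) b b∈))

      -- Any atom may be peeled first, which lowers the count by one. When no atom is left, Ω is
      -- empty, because a structure over a nonempty object has an atom.
      atomCount⇒InFk : ∀ k Ω x → atomCount Ω x ≡ k → InFk E k Ω x
      atomCount⇒InFk zero Ω x e with isEmpty? Ω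
      ... | yes empty = isEmptyObj-true⁺ Ω empty
      ... | no ne with p , m ← atom-exists (card Ω) Ω ℕP.≤-refl ne x =
        ⊥-elim (absurd (atoms Ω x) e (∈-filter⁺ (atom? Ω x) (∈-allSub Ω _) (minimal⇒atom Ω x p m)))
        where
        absurd : ∀ (Ss : List (Sub Ω)) {S} → List.length Ss ≡ 0 → S ∈ Ss → ⊥
        absurd [] _ ()
      atomCount⇒InFk (suc k) Ω x e with atoms Ω x in eq
      ... | S ∷ _ with a , b , a∈ , refl ←
              proj₂ (∈-filter⁻ (atom? Ω x) {v = S} {xs = allSub Ω}
                      (subst (S ∈_) (sym eq) (here refl)))
            = S , a , b , a∈ ,
              atomCount⇒InFk k (sel Ω (cmp S)) b (ℕP.suc-injective
                (trans (sym (atomCount-η Ω S a b a∈)) (trans (cong List.length eq) e))) , refl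

      -- The hypothesis only provides some peeling of η(a,b), perhaps starting with another atom
      -- than a. The atom count transfers the conclusion to b.
      InFk-η⁻ : ∀ k Ω S a b → InFη E (sel Ω S) a → InFk E (suc k) Ω (η Ω S a b) →
                InFk E k (sel Ω (cmp S)) b
      InFk-η⁻ k Ω S a b a∈ x∈ = atomCount⇒InFk k _ b (ℕP.suc-injective
        (trans (sym (atomCount-η Ω S a b a∈)) (InFk⇒atomCount (suc k) Ω _ x∈)))

open Splittings

-- Arithmetic of the rational coefficients of exp and log.

module RationalCoefficients where
  open ≡ using (refl; sym; trans; cong)

  altSign : ℕ → ℤ
  altSign zero = ℤ.+ 1
  altSign (suc zero) = ℤ.- (ℤ.+ 1)
  altSign (suc (suc n)) = altSign n

  -- The numerator function inside logCoeffℚ is local to Defs and out of scope here, so the type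
  -- of the lemma about it is left to unification: abstracting suc (suc n) turns its two
  -- arguments into distinct variables J and n.
  localSign-altSign : (J n : ℕ) → _
  logCoeffℚ-suc : ∀ j → logCoeffℚ (suc j) ≡ altSign j ℚ./ suc j
  logCoeffℚ-suc zero = refl
  logCoeffℚ-suc (suc zero) = refl
  logCoeffℚ-suc (suc (suc n)) with suc (suc n)
  ... | J = localSign-altSign J n
  localSign-altSign J zero = refl
  localSign-altSign J (suc zero) = refl
  localSign-altSign J (suc (suc n)) = localSign-altSign J n

  altSign-suc : ∀ n → altSign (suc n) ≡ ℤ.- altSign n
  altSign-suc zero = refl
  altSign-suc (suc zero) = refl
  altSign-suc (suc (suc n)) = altSign-suc n

  -- Cross-multiplication. Normalised fractions hide a gcd, so the equation is moved to unnormalised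
  -- rationals, where equality is an identity of integers.
  /-*-integer : ∀ z d m z' d' .{{_ : ℕ.NonZero d}} .{{_ : ℕ.NonZero d'}} →
    z ℤ.* ℤ.+ m ℤ.* ℤ.+ d' ≡ z' ℤ.* ℤ.+ d → (z ℚ./ d) ℚ.* (ℤ.+ m ℚ./ 1) ≡ z' ℚ./ d'
  /-*-integer z (suc d) m z' (suc d') e = ℚP.toℚᵘ-injective (ℚᵘP.≃-trans
    (ℚP.toℚᵘ-homo-* (z ℚ./ suc d) (ℤ.+ m ℚ./ 1)) (ℚᵘP.≃-trans
    (ℚᵘP.*-cong (ℚP.toℚᵘ-fromℚᵘ (mkℚᵘ z d)) (ℚP.toℚᵘ-fromℚᵘ (mkℚᵘ (ℤ.+ m) 0)))
    (ℚᵘP.≃-trans (*≡* (trans e (cong (λ k → z' ℤ.* ℤ.+ suc k) (sym (ℕP.*-identityʳ d)))))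
      (ℚᵘP.≃-sym (ℚP.toℚᵘ-fromℚᵘ (mkℚᵘ z' d'))))))

  fromℕ-suc : ∀ n → ℤ.+ suc n ℚ./ 1 ≡ ℚ.1ℚ ℚ.+ (ℤ.+ n ℚ./ 1)
  fromℕ-suc n = ℚP.toℚᵘ-injective (ℚᵘP.≃-trans (ℚP.toℚᵘ-fromℚᵘ (mkℚᵘ (ℤ.+ suc n) 0))
    (ℚᵘP.≃-sym (ℚᵘP.≃-trans (ℚP.toℚᵘ-homo-+ ℚ.1ℚ (ℤ.+ n ℚ./ 1)) (ℚᵘP.≃-trans
      (ℚᵘP.+-congʳ (toℚᵘ ℚ.1ℚ) (ℚP.toℚᵘ-fromℚᵘ (mkℚᵘ (ℤ.+ n) 0)))
      (*≡* (cong (ℤ._* ℤ.+ 1) (cong (λ k → (ℤ.+ 1) ℤ.+ k) (ℤP.*-identityʳ (ℤ.+ n)))))))))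

  neg-/1 : ∀ z → (ℤ.- z) ℚ./ 1 ≡ ℚ.- (z ℚ./ 1)
  neg-/1 z = ℚP.toℚᵘ-injective (ℚᵘP.≃-trans (ℚP.toℚᵘ-fromℚᵘ (mkℚᵘ (ℤ.- z) 0))
    (ℚᵘP.≃-sym (ℚᵘP.≃-trans (ℚP.toℚᵘ-homo‿- (z ℚ./ 1))
      (ℚᵘP.-‿cong (ℚP.toℚᵘ-fromℚᵘ (mkℚᵘ z 0))))))

  invFactℚ-suc : ∀ n → invFactℚ (suc n) ℚ.* (ℤ.+ suc n ℚ./ 1) ≡ invFactℚ n
  invFactℚ-suc n = /-*-integer (ℤ.+ 1) (suc n !) (suc n) (ℤ.+ 1) (n !)
    {{ℕP._!≢0 (suc n)}} {{ℕP._!≢0 n}}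
    (trans (cong (ℤ._* ℤ.+ (n !)) (ℤP.*-identityˡ (ℤ.+ suc n)))
      (trans (sym (ℤP.pos-* (suc n) (n !))) (sym (ℤP.*-identityˡ _))))

  logCoeffℚ-numerator : ∀ j → logCoeffℚ (suc j) ℚ.* (ℤ.+ suc j ℚ./ 1) ≡ altSign j ℚ./ 1
  logCoeffℚ-numerator j = trans (cong (ℚ._* (ℤ.+ suc j ℚ./ 1)) (logCoeffℚ-suc j))
    (/-*-integer (altSign j) (suc j) (suc j) (altSign j) 1 (ℤP.*-identityʳ _))

  reciprocal-suc : ∀ n → (ℤ.+ 1 ℚ./ suc n) ℚ.* (ℤ.+ suc n ℚ./ 1) ≡ ℚ.1ℚ
  reciprocal-suc n = /-*-integer (ℤ.+ 1) (suc n) (suc n) (ℤ.+ 1) 1 (ℤP.*-identityʳ _)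

open RationalCoefficients

-- Finite sums and convolutions over a commutative ring.

module FiniteSums {c ℓ} (R : CommutativeRing c ℓ) where
  open CommutativeRing R
  open CommutativeSemigroupProperties +-commutativeSemigroup using (interchange; x∙yz≈y∙xz)
  open SetoidReasoning setoid

  sumOver : ∀ {a} {A : Set a} → List A → (A → Carrier) → Carrier
  sumOver xs f = List.foldr _+_ 0# (List.map f xs)

  module _ {a} {A : Set a} where

    sumOver-cong-∈ : ∀ (xs : List A) {f g} → (∀ x → x ∈ xs → f x ≈ g x) →
                     sumOver xs f ≈ sumOver xs g
    sumOver-cong-∈ [] e = refl
    sumOver-cong-∈ (x ∷ xs) e =
      +-cong (e x (here ≡.refl)) (sumOver-cong-∈ xs (λ y y∈ → e y (there y∈)))

    sumOver-cong : ∀ (xs : List A) {f g} → (∀ x → f x ≈ g x) → sumOver xs f ≈ sumOver xs g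
    sumOver-cong xs e = sumOver-cong-∈ xs (λ x _ → e x)

    sumOver-0 : ∀ (xs : List A) → sumOver xs (λ _ → 0#) ≈ 0#
    sumOver-0 [] = refl
    sumOver-0 (x ∷ xs) = trans (+-identityˡ _) (sumOver-0 xs)

    sumOver-+ : ∀ (xs : List A) f g →
                sumOver xs (λ x → f x + g x) ≈ sumOver xs f + sumOver xs g
    sumOver-+ [] f g = sym (+-identityˡ 0#)
    sumOver-+ (x ∷ xs) f g = trans (+-congˡ (sumOver-+ xs f g)) (interchange _ _ _ _)

    sumOver-*ˡ : ∀ (xs : List A) k f → sumOver xs (λ x → k * f x) ≈ k * sumOver xs f
    sumOver-*ˡ [] k f = sym (zeroʳ k)
    sumOver-*ˡ (x ∷ xs) k f = trans (+-congˡ (sumOver-*ˡ xs k f)) (sym (distribˡ k _ _))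

    sumOver-*ʳ : ∀ (xs : List A) k f → sumOver xs (λ x → f x * k) ≈ sumOver xs f * k
    sumOver-*ʳ xs k f = trans (sumOver-cong xs (λ x → *-comm (f x) k))
      (trans (sumOver-*ˡ xs k f) (*-comm k _))

    sumOver-++ : ∀ (xs ys : List A) f → sumOver (xs ++ ys) f ≈ sumOver xs f + sumOver ys f
    sumOver-++ [] ys f = sym (+-identityˡ _)
    sumOver-++ (x ∷ xs) ys f = trans (+-congˡ (sumOver-++ xs ys f)) (sym (+-assoc _ _ _))

    sumOver-↭ : ∀ {xs ys : List A} f → xs ↭ ys → sumOver xs f ≈ sumOver ys f
    sumOver-↭ f Perm.refl = refl
    sumOver-↭ f (Perm.prep x p) = +-congˡ (sumOver-↭ f p)
    sumOver-↭ f (Perm.swap x y p) =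
      trans (+-congˡ (+-congˡ (sumOver-↭ f p))) (x∙yz≈y∙xz _ _ _)
    sumOver-↭ f (Perm.trans p q) = trans (sumOver-↭ f p) (sumOver-↭ f q)

    sumOver-filter : ∀ {P : A → Set} (P? : ∀ x → Dec (P x)) xs f →
      sumOver xs (λ x → if ⌊ P? x ⌋ then f x else 0#) ≈ sumOver (List.filter P? xs) f
    sumOver-filter P? [] f = refl
    sumOver-filter P? (x ∷ xs) f with P? x
    ... | yes _ = +-congˡ (sumOver-filter P? xs f)
    ... | no _ = trans (+-identityˡ _) (sumOver-filter P? xs f)

    sumOver-map : ∀ {b} {B : Set b} (h : B → A) xs f →
                  sumOver (List.map h xs) f ≈ sumOver xs (f ∘ h)
    sumOver-map h [] f = refl
    sumOver-map h (x ∷ xs) f = +-congˡ (sumOver-map h xs f)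

    sumOver-concatMap : ∀ {b} {B : Set b} (h : B → List A) xs f →
      sumOver (List.concatMap h xs) f ≈ sumOver xs (λ x → sumOver (h x) f)
    sumOver-concatMap h [] f = refl
    sumOver-concatMap h (x ∷ xs) f =
      trans (sumOver-++ (h x) _ f) (+-congˡ (sumOver-concatMap h xs f))

  sumOver-swap : ∀ {a b} {A : Set a} {B : Set b} (xs : List A) (ys : List B)
    (f : A → B → Carrier) →
    sumOver xs (λ x → sumOver ys (f x)) ≈ sumOver ys (λ y → sumOver xs (λ x → f x y))
  sumOver-swap [] ys f = sym (sumOver-0 ys)
  sumOver-swap (x ∷ xs) ys f = trans (+-congˡ (sumOver-swap xs ys f)) (sym (sumOver-+ ys _ _))

  sumTo : ℕ → (ℕ → Carrier) → Carrier
  sumTo zero f = 0#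
  sumTo (suc n) f = f 0 + sumTo n (f ∘ suc)

  sumOver-upTo : ∀ n f → sumOver (List.upTo n) f ≈ sumTo n f
  sumOver-upTo n f = go n (λ k → k)
    where
    go : ∀ n (g : ℕ → ℕ) → sumOver (List.applyUpTo g n) f ≈ sumTo n (f ∘ g)
    go zero g = refl
    go (suc n) g = +-congˡ (go n (g ∘ suc))

  sumTo-cong : ∀ n {f g} → (∀ k → f k ≈ g k) → sumTo n f ≈ sumTo n g
  sumTo-cong zero e = refl
  sumTo-cong (suc n) e = +-cong (e 0) (sumTo-cong n (e ∘ suc))

  sumTo-*ˡ : ∀ n k f → sumTo n (λ i → k * f i) ≈ k * sumTo n f
  sumTo-*ˡ zero k f = sym (zeroʳ k)
  sumTo-*ˡ (suc n) k f = trans (+-congˡ (sumTo-*ˡ n k (f ∘ suc))) (sym (distribˡ k _ _))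

  sumTo-*ʳ : ∀ n k f → sumTo n (λ i → f i * k) ≈ sumTo n f * k
  sumTo-*ʳ n k f = trans (sumTo-cong n (λ i → *-comm (f i) k))
    (trans (sumTo-*ˡ n k f) (*-comm k _))

  sumOver-cartesianProduct : ∀ {a b} {A : Set a} {B : Set b} (xs : List A) (ys : List B) f →
    sumOver (List.cartesianProduct xs ys) f ≈ sumOver xs (λ x → sumOver ys (λ y → f (x , y)))
  sumOver-cartesianProduct [] ys f = refl
  sumOver-cartesianProduct (x ∷ xs) ys f = trans (sumOver-++ (List.map (x ,_) ys) _ f)
    (+-cong (sumOver-map (x ,_) ys f) (sumOver-cartesianProduct xs ys f))

  sumOver-sumTo-swap : ∀ {a} {A : Set a} (xs : List A) N (f : A → ℕ → Carrier) →
    sumOver xs (λ x → sumTo N (f x)) ≈ sumTo N (λ k → sumOver xs (λ x → f x k))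
  sumOver-sumTo-swap xs zero f = sumOver-0 xs
  sumOver-sumTo-swap xs (suc N) f = trans (sumOver-+ xs _ _)
    (+-congˡ (sumOver-sumTo-swap xs N (λ x → f x ∘ suc)))

  sumTo-0 : ∀ N {f} → (∀ k → f k ≈ 0#) → sumTo N f ≈ 0#
  sumTo-0 zero z = refl
  sumTo-0 (suc N) z = trans (+-cong (z 0) (sumTo-0 N (z ∘ suc))) (+-identityˡ _)

  sumTo-single : ∀ N f m → m < N → (∀ k → k ≢ m → f k ≈ 0#) → sumTo N f ≈ f m
  sumTo-single (suc N) f zero _ z =
    trans (+-congˡ (sumTo-0 N (λ k → z (suc k) (λ ())))) (+-identityʳ _)
  sumTo-single (suc N) f (suc m) (s≤s m<N) z =
    trans (+-cong (z 0 (λ ()))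
            (sumTo-single N (f ∘ suc) m m<N (λ k k≢m → z (suc k) (k≢m ∘ ℕP.suc-injective))))
      (+-identityˡ _)

  -- The sum of f i j over i + j = n. Recursion on n avoids the truncated subtraction n ∸ i and
  -- makes the ring laws provable by induction.
  conv : ℕ → (ℕ → ℕ → Carrier) → Carrier
  conv zero f = f 0 0
  conv (suc n) f = f 0 (suc n) + conv n (λ i j → f (suc i) j)

  conv-cong : ∀ n {f g} → (∀ i j → i ℕ.+ j ≡ n → f i j ≈ g i j) → conv n f ≈ conv n g
  conv-cong zero e = e 0 0 ≡.refl
  conv-cong (suc n) e = +-cong (e 0 (suc n) ≡.refl) (conv-cong n (λ i j p → e (suc i) j (≡.cong suc p)))

  conv-0 : ∀ n → conv n (λ _ _ → 0#) ≈ 0#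
  conv-0 zero = refl
  conv-0 (suc n) = trans (+-identityˡ _) (conv-0 n)

  conv-+ : ∀ n f g → conv n (λ i j → f i j + g i j) ≈ conv n f + conv n g
  conv-+ zero f g = refl
  conv-+ (suc n) f g = trans (+-congˡ (conv-+ n _ _)) (interchange _ _ _ _)

  conv-*ˡ : ∀ n k f → conv n (λ i j → k * f i j) ≈ k * conv n f
  conv-*ˡ zero k f = refl
  conv-*ˡ (suc n) k f = trans (+-congˡ (conv-*ˡ n k _)) (sym (distribˡ k _ _))

  conv-last : ∀ n f → conv (suc n) f ≈ conv n (λ i j → f i (suc j)) + f (suc n) 0
  conv-last zero f = refl
  conv-last (suc n) f = trans (+-congˡ (conv-last n (λ i j → f (suc i) j))) (sym (+-assoc _ _ _))

  conv-comm : ∀ n f → conv n f ≈ conv n (λ i j → f j i)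
  conv-comm zero f = refl
  conv-comm (suc n) f = trans (+-congˡ (conv-comm n (λ i j → f (suc i) j)))
    (trans (+-comm _ _) (sym (conv-last n (λ i j → f j i))))

  -- Both sides run over i + j + k = n. The terms with i = 0 collect to `conv (suc n) (f 0)`, and
  -- the induction hypothesis handles the others.
  conv-assoc : ∀ n (f : ℕ → ℕ → ℕ → Carrier) →
    conv n (λ m k → conv m (λ i j → f i j k)) ≈ conv n (λ i m → conv m (λ j k → f i j k))
  conv-assoc zero f = refl
  conv-assoc (suc n) f = begin
    f 0 0 (suc n) + conv n (λ m k → f 0 (suc m) k + conv m (λ i j → f (suc i) j k))
      ≈⟨ +-congˡ (conv-+ n _ _) ⟩
    f 0 0 (suc n) + (conv n (λ m k → f 0 (suc m) k) + conv n (λ m k → conv m (λ i j → f (suc i) j k)))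
      ≈⟨ +-assoc _ _ _ ⟨
    conv (suc n) (f 0) + conv n (λ m k → conv m (λ i j → f (suc i) j k))
      ≈⟨ +-congˡ (conv-assoc n (λ i → f (suc i))) ⟩
    conv (suc n) (f 0) + conv n (λ i m → conv m (λ j k → f (suc i) j k)) ∎

  conv-head : ∀ n f → (∀ i j → f (suc i) j ≈ 0#) → conv n f ≈ f 0 n
  conv-head zero f z = refl
  conv-head (suc n) f z =
    trans (+-congˡ (trans (conv-cong n (λ i j _ → z i j)) (conv-0 n))) (+-identityʳ _)

  sumTo-conv : ∀ n (f : ℕ → ℕ → Carrier) → sumTo (suc n) (λ k → f k (n ∸ k)) ≈ conv n f
  sumTo-conv zero f = +-identityʳ _
  sumTo-conv (suc n) f = +-congˡ (sumTo-conv n (λ i j → f (suc i) j))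

  convV : ∀ {r} → Vec ℕ r → (Vec ℕ r → Vec ℕ r → Carrier) → Carrier
  convV [] f = f [] []
  convV (n ∷ ns) f = conv n (λ i j → convV ns (λ a b → f (i ∷ a) (j ∷ b)))

  convV-cong : ∀ {r} (n : Vec ℕ r) {f g} →
    (∀ a b → Vec.zipWith ℕ._+_ a b ≡ n → f a b ≈ g a b) → convV n f ≈ convV n g
  convV-cong [] e = e [] [] ≡.refl
  convV-cong (n ∷ ns) e = conv-cong n λ i j p → convV-cong ns λ a b q → e _ _ (≡.cong₂ _∷_ p q)

  convV-0 : ∀ {r} (n : Vec ℕ r) → convV n (λ _ _ → 0#) ≈ 0#
  convV-0 [] = refl
  convV-0 (n ∷ ns) = trans (conv-cong n (λ _ _ _ → convV-0 ns)) (conv-0 n)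

  convV-+ : ∀ {r} (n : Vec ℕ r) f g →
    convV n (λ a b → f a b + g a b) ≈ convV n f + convV n g
  convV-+ [] f g = refl
  convV-+ (n ∷ ns) f g = trans (conv-cong n (λ _ _ _ → convV-+ ns _ _)) (conv-+ n _ _)

  convV-*ˡ : ∀ {r} (n : Vec ℕ r) k f → convV n (λ a b → k * f a b) ≈ k * convV n f
  convV-*ˡ [] k f = refl
  convV-*ˡ (n ∷ ns) k f = trans (conv-cong n (λ _ _ _ → convV-*ˡ ns k _)) (conv-*ˡ n k _)

  convV-comm : ∀ {r} (n : Vec ℕ r) f → convV n f ≈ convV n (λ a b → f b a)
  convV-comm [] f = refl
  convV-comm (n ∷ ns) f = trans (conv-cong n (λ _ _ _ → convV-comm ns _)) (conv-comm n _)

  convV-conv-swap : ∀ {r} (n : Vec ℕ r) k (f : Vec ℕ r → Vec ℕ r → ℕ → ℕ → Carrier) →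
    convV n (λ a b → conv k (f a b)) ≈ conv k (λ i j → convV n (λ a b → f a b i j))
  convV-conv-swap n zero f = refl
  convV-conv-swap n (suc k) f =
    trans (convV-+ n _ _) (+-congˡ (convV-conv-swap n k (λ a b i j → f a b (suc i) j)))

  convV-assoc : ∀ {r} (n : Vec ℕ r) (f : Vec ℕ r → Vec ℕ r → Vec ℕ r → Carrier) →
    convV n (λ m d → convV m (λ a b → f a b d)) ≈ convV n (λ a m → convV m (λ b d → f a b d))
  convV-assoc [] f = refl
  convV-assoc (n ∷ ns) f = begin
    conv n (λ m k → convV ns (λ v d → conv m (λ i j → convV v (λ a b → f (i ∷ a) (j ∷ b) (k ∷ d)))))
      ≈⟨ conv-cong n (λ m k _ → convV-conv-swap ns m _) ⟩
    conv n (λ m k → conv m (λ i j → convV ns (λ v d → convV v (λ a b → f (i ∷ a) (j ∷ b) (k ∷ d)))))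
      ≈⟨ conv-assoc n _ ⟩
    conv n (λ i m → conv m (λ j k → convV ns (λ v d → convV v (λ a b → f (i ∷ a) (j ∷ b) (k ∷ d)))))
      ≈⟨ conv-cong n (λ i m _ → conv-cong m (λ j k _ → convV-assoc ns _)) ⟩
    conv n (λ i m → conv m (λ j k → convV ns (λ a v → convV v (λ b d → f (i ∷ a) (j ∷ b) (k ∷ d)))))
      ≈⟨ conv-cong n (λ i m _ → convV-conv-swap ns m _) ⟨
    conv n (λ i m → convV ns (λ a v → conv m (λ j k → convV v (λ b d → f (i ∷ a) (j ∷ b) (k ∷ d))))) ∎

  -- The bridge from the product of series as defined, a sum over `below n` with truncated
  -- subtraction, to `convV`.
  sumOver-below : ∀ {r} (n : Vec ℕ r) (f : Vec ℕ r → Vec ℕ r → Carrier) →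
    sumOver (below n) (λ m → f m (Vec.zipWith _∸_ n m)) ≈ convV n f
  sumOver-below [] f = +-identityʳ _
  sumOver-below (n ∷ ns) f = begin
    sumOver (below (n ∷ ns)) (λ m → f m (Vec.zipWith _∸_ (n ∷ ns) m))
      ≈⟨ sumOver-concatMap (λ k → List.map (k ∷_) (below ns)) (List.upTo (suc n)) _ ⟩
    sumOver (List.upTo (suc n)) (λ k → sumOver (List.map (k ∷_) (below ns)) _)
      ≈⟨ sumOver-cong (List.upTo (suc n)) (λ k → trans (sumOver-map (k ∷_) (below ns) _)
           (sumOver-below ns (λ a b → f (k ∷ a) ((n ∸ k) ∷ b)))) ⟩
    sumOver (List.upTo (suc n)) (λ k → convV ns (λ a b → f (k ∷ a) ((n ∸ k) ∷ b)))
      ≈⟨ sumOver-upTo (suc n) _ ⟩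
    sumTo (suc n) (λ k → convV ns (λ a b → f (k ∷ a) ((n ∸ k) ∷ b)))
      ≈⟨ sumTo-conv n (λ i j → convV ns (λ a b → f (i ∷ a) (j ∷ b))) ⟩
    convV (n ∷ ns) f ∎

-- The commutative ring of formal power series.

module SeriesRing {c ℓ} (Λ : CommutativeRing c ℓ) (φ : ℚ → CommutativeRing.Carrier Λ) (r : ℕ) where
  open CommutativeRing Λ
  open FiniteSums Λ
  open PowerSeries Λ φ r

  _≋_ : Series → Series → Set ℓ
  A ≋ B = ∀ n → A n ≈ B n

  *S-conv : ∀ A B n → (A *S B) n ≈ convV n (λ a b → A a * B b)
  *S-conv A B n = sumOver-below n (λ a b → A a * B b)

  *S-cong : ∀ {A A' B B'} → A ≋ A' → B ≋ B' → (A *S B) ≋ (A' *S B')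
  *S-cong e e' n = sumOver-cong (below n) (λ m → *-cong (e m) (e' _))

  *S-assoc : ∀ A B C → ((A *S B) *S C) ≋ (A *S (B *S C))
  *S-assoc A B C n = begin
    ((A *S B) *S C) n
      ≈⟨ *S-conv (A *S B) C n ⟩
    convV n (λ m d → (A *S B) m * C d)
      ≈⟨ convV-cong n (λ m d _ → expandˡ m d) ⟩
    convV n (λ m d → convV m (λ a b → A a * (B b * C d)))
      ≈⟨ convV-assoc n _ ⟩
    convV n (λ a m → convV m (λ b d → A a * (B b * C d)))
      ≈⟨ convV-cong n (λ a m _ → trans (convV-*ˡ m (A a) _) (*-congˡ (sym (*S-conv B C m)))) ⟩
    convV n (λ a m → A a * (B *S C) m)
      ≈⟨ *S-conv A (B *S C) n ⟨
    (A *S (B *S C)) n ∎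
    where
    open SetoidReasoning setoid
    expandˡ : ∀ m d → (A *S B) m * C d ≈ convV m (λ a b → A a * (B b * C d))
    expandˡ m d = begin
      (A *S B) m * C d ≈⟨ *-comm _ _ ⟩
      C d * (A *S B) m ≈⟨ *-congˡ (*S-conv A B m) ⟩
      C d * convV m (λ a b → A a * B b) ≈⟨ convV-*ˡ m (C d) _ ⟨
      convV m (λ a b → C d * (A a * B b))
        ≈⟨ convV-cong m (λ a b _ → trans (*-comm _ _) (*-assoc _ _ _)) ⟩
      convV m (λ a b → A a * (B b * C d)) ∎

  *S-comm : ∀ A B → (A *S B) ≋ (B *S A)
  *S-comm A B n = trans (*S-conv A B n) (trans (convV-comm n _)
    (trans (convV-cong n (λ a b _ → *-comm _ _)) (sym (*S-conv B A n))))

  -- The number of variables is quantified anew because the induction removes one. A positive first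
  -- exponent kills the factor `oneS`, so only the head of the convolution survives.
  oneS-identity : ∀ {r} (n : Vec ℕ r) (B : Vec ℕ r → Carrier) →
    convV n (λ a b → PowerSeries.oneS Λ φ r a * B b) ≈ B n
  oneS-identity [] B = *-identityˡ _
  oneS-identity (n ∷ ns) B =
    trans (conv-head n _ (λ i j → trans (convV-cong ns (λ a b _ → zeroˡ _)) (convV-0 ns)))
          (oneS-identity ns (λ b → B (n ∷ b)))

  *S-identityˡ : ∀ A → (oneS *S A) ≋ A
  *S-identityˡ A n = trans (*S-conv oneS A n) (oneS-identity n A)

  *S-distribˡ : ∀ A B C → (A *S (λ n → B n + C n)) ≋ (λ n → (A *S B) n + (A *S C) n)
  *S-distribˡ A B C n =
    trans (sumOver-cong (below n) (λ m → distribˡ _ _ _)) (sumOver-+ (below n) _ _)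

  *S-distribʳ : ∀ A B C → ((λ n → B n + C n) *S A) ≋ (λ n → (B *S A) n + (C *S A) n)
  *S-distribʳ A B C n =
    trans (sumOver-cong (below n) (λ m → distribʳ _ _ _)) (sumOver-+ (below n) _ _)

  -- Makes `FiniteSums` and the general ring lemmas available for series themselves, as needed for
  -- partial sums of exp, log and the geometric series.
  seriesRing : CommutativeRing c ℓ
  seriesRing = record
    { Carrier = Series
    ; _≈_ = _≋_
    ; _+_ = λ A B n → A n + B n
    ; _*_ = _*S_
    ; -_ = λ A n → - A n
    ; 0# = λ _ → 0#
    ; 1# = oneS
    ; isCommutativeRing = record
      { isRing = record
        { +-isAbelianGroup = record
          { isGroup = record
            { isMonoid = record
              { isSemigroup = record
                { isMagma = record
                  { isEquivalence = record
                    { refl = λ _ → refl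
                    ; sym = λ e n → sym (e n)
                    ; trans = λ e e' n → trans (e n) (e' n)
                    }
                  ; ∙-cong = λ e e' n → +-cong (e n) (e' n)
                  }
                ; assoc = λ A B C n → +-assoc _ _ _
                }
              ; identity = (λ A n → +-identityˡ _) , (λ A n → +-identityʳ _)
              }
            ; inverse = (λ A n → -‿inverseˡ _) , (λ A n → -‿inverseʳ _)
            ; ⁻¹-cong = λ e n → -‿cong (e n)
            }
          ; comm = λ A B n → +-comm _ _
          }
        ; *-cong = λ {A} {A'} {B} {B'} → *S-cong {A} {A'} {B} {B'}
        ; *-assoc = *S-assoc
        ; *-identity = *S-identityˡ , λ A n → trans (*S-comm A oneS n) (*S-identityˡ A n)
        ; distrib = *S-distribˡ , *S-distribʳ
        }
      ; *-comm = *S-comm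
      }
    }

-- Natural numbers and rationals as scalars.

module Scalars {c ℓ} (Λ : CommutativeRing c ℓ) (φ : ℚ → CommutativeRing.Carrier Λ)
               (hom : ContainsℚVia Λ φ) where
  open CommutativeRing Λ
  open RingMorphisms.IsRingMonomorphism hom using (+-homo; *-homo; 1#-homo; 0#-homo; -‿homo)

  -- The natural number n as an element of Λ. The recursion unfolds along counting arguments, and
  -- `ν-φ` links it to the rationals.
  ν : ℕ → Carrier
  ν zero = 0#
  ν (suc n) = 1# + ν n

  ν-+ : ∀ m n → ν (m ℕ.+ n) ≈ ν m + ν n
  ν-+ zero n = sym (+-identityˡ _)
  ν-+ (suc m) n = trans (+-congˡ (ν-+ m n)) (sym (+-assoc _ _ _))

  φ-≡ : ∀ {p q} → p ≡ q → φ p ≈ φ q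
  φ-≡ e = reflexive (≡.cong φ e)

  ν-φ : ∀ n → ν n ≈ φ (ℤ.+ n ℚ./ 1)
  ν-φ zero = sym 0#-homo
  ν-φ (suc n) = trans (+-cong (sym 1#-homo) (ν-φ n))
    (trans (sym (+-homo _ _)) (φ-≡ (≡.sym (fromℕ-suc n))))

  φ-*-ν : ∀ {p q} n → p ℚ.* (ℤ.+ n ℚ./ 1) ≡ q → φ p * ν n ≈ φ q
  φ-*-ν n e = trans (*-congˡ (ν-φ n)) (trans (sym (*-homo _ _)) (φ-≡ e))

  -- Multiplication by the image of 1/(n+1) undoes multiplication by n + 1.
  ν-cancel : ∀ n {x y} → ν (suc n) * x ≈ ν (suc n) * y → x ≈ y
  ν-cancel n {x} {y} e = trans (sym (undo x)) (trans (*-congˡ e) (undo y))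
    where
    undo : ∀ z → φ (ℤ.+ 1 ℚ./ suc n) * (ν (suc n) * z) ≈ z
    undo z = trans (sym (*-assoc _ _ _))
      (trans (*-congʳ (trans (φ-*-ν (suc n) (reciprocal-suc n)) 1#-homo)) (*-identityˡ z))

  invFact-zero : φ (invFactℚ 0) ≈ 1#
  invFact-zero = 1#-homo

  invFact-suc : ∀ n → φ (invFactℚ (suc n)) * ν (suc n) ≈ φ (invFactℚ n)
  invFact-suc n = φ-*-ν (suc n) (invFactℚ-suc n)

  sign : ℕ → Carrier
  sign zero = 1#
  sign (suc n) = - sign n

  φ-altSign : ∀ n → φ (altSign n ℚ./ 1) ≈ sign n
  φ-altSign zero = 1#-homo
  φ-altSign (suc n) =
    trans (φ-≡ (≡.trans (≡.cong (ℚ._/ 1) (altSign-suc n)) (neg-/1 (altSign n))))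
      (trans (-‿homo _) (-‿cong (φ-altSign n)))

  logCoeff-zero : φ (logCoeffℚ 0) ≈ 0#
  logCoeff-zero = 0#-homo

  logCoeff-suc : ∀ j → φ (logCoeffℚ (suc j)) * ν (suc j) ≈ sign j
  logCoeff-suc j = trans (φ-*-ν (suc j) (logCoeffℚ-numerator j)) (φ-altSign j)

-- The logarithm of an exponential.

module LogExp {c ℓ} (Λ : CommutativeRing c ℓ) (φ : ℚ → CommutativeRing.Carrier Λ)
              (hom : ContainsℚVia Λ φ) (r : ℕ) where
  open CommutativeRing Λ
  open RingProperties ring using (-‿distribˡ-*; -‿involutive; -0#≈0#)
  open CommutativeSemigroupProperties *-commutativeSemigroup using (x∙yz≈y∙xz)
  open Scalars Λ φ hom
  open FiniteSums Λ
  open PowerSeries Λ φ r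
  open SeriesRing Λ φ r
  private
    module S = CommutativeRing seriesRing
    module SP = RingProperties S.ring
    module Sum = FiniteSums seriesRing
    module ≋-Reasoning = SetoidReasoning S.setoid

  infixr 8 _•_
  _•_ : Carrier → Series → Series
  (k • A) n = k * A n

  •-*S : ∀ k A B → ((k • A) *S B) ≋ (k • (A *S B))
  •-*S k A B n = trans (sumOver-cong (below n) (λ m → *-assoc _ _ _)) (sumOver-*ˡ (below n) k _)

  *S-• : ∀ k A B → (A *S (k • B)) ≋ (k • (A *S B))
  *S-• k A B = S.trans {A *S (k • B)} {(k • B) *S A} {k • (A *S B)} (*S-comm A (k • B))
    (S.trans {(k • B) *S A} {k • (B *S A)} {k • (A *S B)} (•-*S k B A) (λ n → *-congˡ (*S-comm B A n)))

  sumTo-at : ∀ N f n → Sum.sumTo N f n ≡ sumTo N (λ k → f k n)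
  sumTo-at zero f n = ≡.refl
  sumTo-at (suc N) f n = ≡.cong (f 0 n +_) (sumTo-at N (f ∘ suc) n)

  -- The Euler operator Σᵢ zᵢ ∂/∂zᵢ.
  θ : Series → Series
  θ A n = ν (totalDeg n) * A n

  θ-• : ∀ k A → θ (k • A) ≋ (k • θ A)
  θ-• k A n = x∙yz≈y∙xz _ _ _

  -- θ is a derivation because the total degree is additive over the index pairs a + b = n of the
  -- product.
  θ-*S : ∀ A B → θ (A *S B) ≋ ((θ A *S B) S.+ (A *S θ B))
  θ-*S A B n = begin
    ν (totalDeg n) * (A *S B) n
      ≈⟨ *-congˡ (*S-conv A B n) ⟩
    ν (totalDeg n) * convV n (λ a b → A a * B b)
      ≈⟨ convV-*ˡ n _ _ ⟨
    convV n (λ a b → ν (totalDeg n) * (A a * B b))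
      ≈⟨ convV-cong n leibniz ⟩
    convV n (λ a b → θ A a * B b + A a * θ B b)
      ≈⟨ convV-+ n _ _ ⟩
    convV n (λ a b → θ A a * B b) + convV n (λ a b → A a * θ B b)
      ≈⟨ +-cong (*S-conv (θ A) B n) (*S-conv A (θ B) n) ⟨
    (θ A *S B) n + (A *S θ B) n ∎
    where
    open SetoidReasoning setoid
    leibniz : ∀ a b → Vec.zipWith ℕ._+_ a b ≡ n →
              ν (totalDeg n) * (A a * B b) ≈ θ A a * B b + A a * θ B b
    leibniz a b ≡.refl = begin
      ν (totalDeg (Vec.zipWith ℕ._+_ a b)) * (A a * B b)
        ≈⟨ *-congʳ (trans (reflexive (≡.cong ν (totalDeg-+ a b))) (ν-+ (totalDeg a) (totalDeg b))) ⟩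
      (ν (totalDeg a) + ν (totalDeg b)) * (A a * B b)
        ≈⟨ distribʳ _ _ _ ⟩
      ν (totalDeg a) * (A a * B b) + ν (totalDeg b) * (A a * B b)
        ≈⟨ +-cong (sym (*-assoc _ _ _)) (x∙yz≈y∙xz _ _ _) ⟩
      θ A a * B b + A a * θ B b ∎

  θ-one : θ oneS ≋ S.0#
  θ-one n with isZeroIdx n in eq
  ... | false = zeroʳ _
  ... | true = trans (*-congʳ (reflexive (≡.cong ν (deg0 n eq)))) (zeroˡ _)
    where
    deg0 : ∀ {r} (n : Vec ℕ r) → isZeroIdx n ≡ true → totalDeg n ≡ 0
    deg0 [] e = ≡.refl
    deg0 (zero ∷ n) e = deg0 n e

  θ-sumTo : ∀ N f → θ (Sum.sumTo N f) ≋ Sum.sumTo N (θ ∘ f)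
  θ-sumTo zero f n = zeroʳ _
  θ-sumTo (suc N) f n = trans (distribˡ _ _ _) (+-congˡ (θ-sumTo N (f ∘ suc) n))

  θ-power : ∀ A j → θ (A ^S suc j) ≋ (ν (suc j) • ((A ^S j) *S θ A))
  θ-power A zero = begin
    θ (A *S oneS)                  ≈⟨ θ-*S A oneS ⟩
    (θ A *S oneS) S.+ (A *S θ oneS)
      ≈⟨ S.+-cong {θ A *S oneS} {oneS *S θ A} {A *S θ oneS} {S.0#} (*S-comm (θ A) oneS)
           (S.trans {A *S θ oneS} {A *S S.0#} {S.0#}
             (*S-cong {A} {A} {θ oneS} {S.0#} (λ _ → refl) θ-one) (S.zeroʳ A)) ⟩
    (oneS *S θ A) S.+ S.0#         ≈⟨ S.+-identityʳ (oneS *S θ A) ⟩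
    oneS *S θ A                    ≈⟨ (λ n → trans (*-congʳ (+-identityʳ 1#)) (*-identityˡ _)) ⟨
    ν 1 • (oneS *S θ A)            ∎
    where open ≋-Reasoning
  θ-power A (suc j) = begin
    θ (A *S P)                                ≈⟨ θ-*S A P ⟩
    (θ A *S P) S.+ (A *S θ P)
      ≈⟨ S.+-cong {θ A *S P} {P *S θ A} {A *S θ P} {A *S (ν (suc j) • (Q *S θ A))}
           (*S-comm (θ A) P) (*S-cong {A} {A} {θ P} (λ _ → refl) (θ-power A j)) ⟩
    (P *S θ A) S.+ (A *S (ν (suc j) • (Q *S θ A)))
      ≈⟨ S.+-congˡ {P *S θ A} {A *S (ν (suc j) • (Q *S θ A))} {ν (suc j) • (A *S (Q *S θ A))}
           (*S-• (ν (suc j)) A (Q *S θ A)) ⟩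
    (P *S θ A) S.+ (ν (suc j) • (A *S (Q *S θ A)))
      ≈⟨ S.+-congˡ {P *S θ A} {ν (suc j) • (A *S (Q *S θ A))} {ν (suc j) • (P *S θ A)}
           (λ n → *-congˡ (sym (*S-assoc A Q (θ A) n))) ⟩
    (P *S θ A) S.+ (ν (suc j) • (P *S θ A))
      ≈⟨ (λ n → trans (+-congʳ (sym (*-identityˡ _))) (sym (distribʳ _ _ _))) ⟩
    ν (suc (suc j)) • (P *S θ A) ∎
    where
    open ≋-Reasoning
    Q = A ^S j
    P = A ^S suc j

  -- Absence of terms of total degree below k. High order is what allows a truncation error to be
  -- discarded in a given degree.
  Order : ℕ → Series → Set ℓ
  Order k A = ∀ n → totalDeg n < k → A n ≈ 0#

  order-*S : ∀ {j k A B} → Order j A → Order k B → Order (j ℕ.+ k) (A *S B)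
  order-*S {j} {k} {A} {B} oA oB n n< = trans (*S-conv A B n)
    (trans (convV-cong n (λ a b e → [ (λ a< → trans (*-congʳ (oA a a<)) (zeroˡ _))
                                    , (λ b< → trans (*-congˡ (oB b b<)) (zeroʳ _)) ]′ (small a b e)))
           (convV-0 n))
    where
    small : ∀ a b → Vec.zipWith ℕ._+_ a b ≡ n → totalDeg a < j ⊎ totalDeg b < k
    small a b ≡.refl with totalDeg a ℕP.<? j | totalDeg b ℕP.<? k
    ... | yes a< | _ = inj₁ a<
    ... | no _ | yes b< = inj₂ b<
    ... | no a≮ | no b≮ = inj₁ (⊥-elim (ℕP.<⇒≱ n< (≡.subst (j ℕ.+ k ≤_) (≡.sym (totalDeg-+ a b))
                            (ℕP.+-mono-≤ (ℕP.≮⇒≥ a≮) (ℕP.≮⇒≥ b≮)))))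

  order-^S : ∀ {A} → Order 1 A → ∀ k → Order k (A ^S k)
  order-^S o zero n ()
  order-^S {A} o (suc k) = order-*S {1} {k} {A} {A ^S k} o (order-^S o k)

  order-θ : ∀ {k A} → Order k A → Order k (θ A)
  order-θ o n n< = trans (*-congˡ (o n n<)) (zeroʳ _)

  *S-agree : ∀ {N A A'} B → (∀ n → totalDeg n < N → A n ≈ A' n) →
             ∀ n → totalDeg n < N → (A *S B) n ≈ (A' *S B) n
  *S-agree {N} {A} {A'} B e n n< = trans (*S-conv A B n)
    (trans (convV-cong n (λ a b p → *-congʳ (e a (bound a b p)))) (sym (*S-conv A' B n)))
    where
    bound : ∀ a b → Vec.zipWith ℕ._+_ a b ≡ n → totalDeg a < N
    bound a b ≡.refl = ℕP.≤-<-trans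
      (≡.subst (totalDeg a ≤_) (≡.sym (totalDeg-+ a b)) (ℕP.m≤m+n _ _)) n<

  e : ℕ → Carrier
  e k = φ (invFactℚ k)

  -- A is exp B, expressed through partial sums since B has no constant term.
  record IsExp (B A : Series) : Set ℓ where
    field
      order₁ : Order 1 B
      expand : ∀ N n → totalDeg n < N → A n ≈ sumTo N (λ k → e k * (B ^S k) n)

  module _ {A B : Series} (A≈expB : IsExp B A) where
    open IsExp A≈expB

    private
      U : Series
      U = A -S oneS

    partialExp : ℕ → Series
    partialExp N = Sum.sumTo N (λ k → e k • (B ^S k))

    partialExp-agree : ∀ N n → totalDeg n < N → partialExp N n ≈ A n
    partialExp-agree N n n< =
      trans (reflexive (sumTo-at N (λ k → e k • (B ^S k)) n)) (sym (expand N n n<))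

    -- The truncated form of θ(exp B) = exp B · θB. The constant term dies and (k+1)/(k+1)! = 1/k!
    -- shifts the others, so the right side has one term fewer.
    θ-partialExp : ∀ N → θ (partialExp (suc N)) ≋ (partialExp N *S θ B)
    θ-partialExp N = begin
      θ (partialExp (suc N))
        ≈⟨ θ-sumTo (suc N) (λ k → e k • (B ^S k)) ⟩
      θ (e 0 • oneS) S.+ Sum.sumTo N (λ k → θ (e (suc k) • (B ^S suc k)))
        ≈⟨ S.+-cong {θ (e 0 • oneS)} {S.0#} {Sum.sumTo N (λ k → θ (e (suc k) • (B ^S suc k)))}
             {Sum.sumTo N (λ k → (e k • (B ^S k)) *S θ B)}
             (λ n → trans (θ-• (e 0) oneS n) (trans (*-congˡ (θ-one n)) (zeroʳ _)))
             (Sum.sumTo-cong N term) ⟩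
      S.0# S.+ Sum.sumTo N (λ k → (e k • (B ^S k)) *S θ B)
        ≈⟨ S.+-identityˡ _ ⟩
      Sum.sumTo N (λ k → (e k • (B ^S k)) *S θ B)
        ≈⟨ Sum.sumTo-*ʳ N (θ B) _ ⟩
      partialExp N *S θ B ∎
      where
      open ≋-Reasoning
      term : ∀ k → θ (e (suc k) • (B ^S suc k)) ≋ ((e k • (B ^S k)) *S θ B)
      term k n = trans (θ-• (e (suc k)) (B ^S suc k) n)
        (trans (*-congˡ (θ-power B k n)) (trans (sym (*-assoc _ _ _))
        (trans (*-congʳ (invFact-suc k)) (sym (•-*S (e k) (B ^S k) (θ B) n)))))

    θ-exp : θ A ≋ (A *S θ B)
    θ-exp n = trans (*-congˡ (sym (partialExp-agree (suc N) n (ℕP.m<n⇒m<1+n (ℕP.n<1+n _)))))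
      (trans (θ-partialExp N n)
             (*S-agree {N} {partialExp N} {A} (θ B) (partialExp-agree N) n (ℕP.n<1+n _)))
      where
      -- The product with θB may involve A in every degree up to that of n, so N has to exceed it.
      N = suc (totalDeg n)

    order-U : Order 1 U
    order-U n n< = trans (+-congʳ (trans (expand 1 n n<)
      (trans (+-identityʳ _) (trans (*-congʳ invFact-zero) (*-identityˡ _))))) (-‿inverseʳ _)

    one+U : (A S.+ S.- U) ≋ oneS
    one+U n = begin
      A n + - (A n - oneS n) ≈⟨ +-congˡ (⁻¹-anti-homo‿- (A n) (oneS n)) ⟩
      A n + (oneS n - A n)   ≈⟨ x+yz≈y+xz _ _ _ ⟩
      oneS n + (A n - A n)   ≈⟨ +-congˡ (-‿inverseʳ _) ⟩
      oneS n + 0#            ≈⟨ +-identityʳ _ ⟩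
      oneS n ∎
      where
      open SetoidReasoning setoid
      open AbelianGroupProperties +-abelianGroup using (⁻¹-anti-homo‿-)
      open CommutativeSemigroupProperties +-commutativeSemigroup
        using () renaming (x∙yz≈y∙xz to x+yz≈y+xz)

    -- The truncated geometric series for A⁻¹ = 1/(1 + U).
    partialInverse : ℕ → Series
    partialInverse N = Sum.sumTo N (λ j → sign j • (U ^S j))

    partialInverse-suc : ∀ N →
      partialInverse (suc N) ≋ (oneS S.+ ((S.- U) *S partialInverse N))
    partialInverse-suc N n = +-cong (*-identityˡ _)
      (trans (Sum.sumTo-cong N term n) (Sum.sumTo-*ˡ N (S.- U) (λ j → sign j • (U ^S j)) n))
      where
      term : ∀ j → (sign (suc j) • (U ^S suc j)) ≋ ((S.- U) *S (sign j • (U ^S j)))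
      term j n = trans (sym (-‿distribˡ-* _ _))
        (trans (-‿cong (sym (*S-• (sign j) U (U ^S j) n)))
               (SP.-‿distribˡ-* U (sign j • (U ^S j)) n))

    -- The finite geometric sum, with its remainder (-U)^N kept explicit. In the induction A - U
    -- collapses to 1 and U times the old remainder is the new one up to sign.
    partialInverse-*S : ∀ N → (partialInverse N *S A) ≋ (oneS S.- (sign N • (U ^S N)))
    partialInverse-*S zero n =
      trans (S.zeroˡ A n) (sym (trans (+-congˡ (-‿cong (*-identityˡ _))) (-‿inverseʳ _)))
    partialInverse-*S (suc N) = begin
      partialInverse (suc N) *S A
        ≈⟨ *S-cong {partialInverse (suc N)} {oneS S.+ (W *S V)} {A} {A}
             (partialInverse-suc N) (λ _ → refl) ⟩
      (oneS S.+ (W *S V)) *S A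
        ≈⟨ S.distribʳ A oneS (W *S V) ⟩
      (oneS *S A) S.+ ((W *S V) *S A)
        ≈⟨ S.+-cong {oneS *S A} {A} {(W *S V) *S A} {W *S (V *S A)}
             (*S-identityˡ A) (*S-assoc W V A) ⟩
      A S.+ (W *S (V *S A))
        ≈⟨ S.+-congˡ {A} {W *S (V *S A)} {W *S (oneS S.- P)}
             (*S-cong {W} {W} {V *S A} (λ _ → refl) (partialInverse-*S N)) ⟩
      A S.+ (W *S (oneS S.- P))
        ≈⟨ S.+-congˡ {A} {W *S (oneS S.- P)} {W S.+ (U *S P)} expandP ⟩
      A S.+ (W S.+ (U *S P))
        ≈⟨ S.+-assoc A W (U *S P) ⟨
      (A S.+ W) S.+ (U *S P)
        ≈⟨ S.+-cong {A S.+ W} {oneS} {U *S P} {S.- (sign (suc N) • (U ^S suc N))}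
             one+U signed ⟩
      oneS S.- (sign (suc N) • (U ^S suc N)) ∎
      where
      open ≋-Reasoning
      W = S.- U
      V = partialInverse N
      P = sign N • (U ^S N)
      expandP : (W *S (oneS S.- P)) ≋ (W S.+ (U *S P))
      expandP = begin
        W *S (oneS S.- P) ≈⟨ S.distribˡ W oneS (S.- P) ⟩
        (W *S oneS) S.+ (W *S (S.- P))
          ≈⟨ S.+-cong {W *S oneS} {W} {W *S (S.- P)} {U *S P}
               (S.*-identityʳ W)
               (S.trans {W *S (S.- P)} {S.- (U *S (S.- P))} {U *S P}
                 (S.sym {S.- (U *S (S.- P))} {W *S (S.- P)} (SP.-‿distribˡ-* U (S.- P)))
                 (S.trans {S.- (U *S (S.- P))} {S.- (S.- (U *S P))} {U *S P}
                   (S.-‿cong {U *S (S.- P)} {S.- (U *S P)}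
                     (S.sym {S.- (U *S P)} {U *S (S.- P)} (SP.-‿distribʳ-* U P)))
                   (SP.-‿involutive (U *S P)))) ⟩
        W S.+ (U *S P) ∎
      signed : (U *S P) ≋ (S.- (sign (suc N) • (U ^S suc N)))
      signed n = trans (*S-• (sign N) U (U ^S N) n)
        (sym (trans (-‿cong (sym (-‿distribˡ-* _ _))) (-‿involutive _)))

    partialLog : ℕ → Series
    partialLog N = Sum.sumTo N (λ j → φ (logCoeffℚ j) • (U ^S j))

    logS-partialLog : ∀ n → logS A n ≈ partialLog (suc (totalDeg n)) n
    logS-partialLog n = trans (sumOver-upTo (suc (totalDeg n)) _)
      (sym (reflexive (sumTo-at (suc (totalDeg n)) (λ j → φ (logCoeffℚ j) • (U ^S j)) n)))

    θ-U : θ U ≋ θ A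
    θ-U n = trans (distribˡ _ _ _) (trans (+-congˡ vanish) (+-identityʳ _))
      where
      vanish : ν (totalDeg n) * - oneS n ≈ 0#
      vanish = trans (sym (RingProperties.-‿distribʳ-* ring _ _)) (trans (-‿cong (θ-one n)) -0#≈0#)

    -- The factor j + 1 of the power rule cancels the denominator of the coefficient (-1)^j/(j+1),
    -- which leaves the geometric series for A⁻¹.
    θ-partialLog : ∀ N → θ (partialLog (suc N)) ≋ (partialInverse N *S θ U)
    θ-partialLog N = begin
      θ (partialLog (suc N))
        ≈⟨ θ-sumTo (suc N) (λ j → φ (logCoeffℚ j) • (U ^S j)) ⟩
      θ (φ (logCoeffℚ 0) • oneS) S.+ Sum.sumTo N (λ j → θ (φ (logCoeffℚ (suc j)) • (U ^S suc j)))
        ≈⟨ S.+-cong {θ (φ (logCoeffℚ 0) • oneS)} {S.0#}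
             {Sum.sumTo N (λ j → θ (φ (logCoeffℚ (suc j)) • (U ^S suc j)))}
             {Sum.sumTo N (λ j → (sign j • (U ^S j)) *S θ U)}
             (λ n → trans (θ-• _ oneS n) (trans (*-congˡ (θ-one n)) (zeroʳ _)))
             (Sum.sumTo-cong N term) ⟩
      S.0# S.+ Sum.sumTo N (λ j → (sign j • (U ^S j)) *S θ U)
        ≈⟨ S.+-identityˡ _ ⟩
      Sum.sumTo N (λ j → (sign j • (U ^S j)) *S θ U)
        ≈⟨ Sum.sumTo-*ʳ N (θ U) _ ⟩
      partialInverse N *S θ U ∎
      where
      open ≋-Reasoning
      term : ∀ j → θ (φ (logCoeffℚ (suc j)) • (U ^S suc j)) ≋ ((sign j • (U ^S j)) *S θ U)
      term j n = trans (θ-• _ (U ^S suc j) n)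
        (trans (*-congˡ (θ-power U j n)) (trans (sym (*-assoc _ _ _))
        (trans (*-congʳ (logCoeff-suc j)) (sym (•-*S (sign j) (U ^S j) (θ U) n)))))

    θ-log : ∀ n → ν (totalDeg n) * logS A n ≈ ν (totalDeg n) * B n
    θ-log n = trans (*-congˡ (logS-partialLog n)) (trans (chain n) (trans (+-congˡ high) (+-identityʳ _)))
      where
      open ≋-Reasoning
      N = totalDeg n
      T = sign N • (U ^S N)
      chain : θ (partialLog (suc N)) ≋ (θ B S.+ (S.- (T *S θ B)))
      chain = begin
        θ (partialLog (suc N)) ≈⟨ θ-partialLog N ⟩
        partialInverse N *S θ U
          ≈⟨ *S-cong {partialInverse N} {partialInverse N} {θ U} {A *S θ B} (λ _ → refl)
               (λ m → trans (θ-U m) (θ-exp m)) ⟩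
        partialInverse N *S (A *S θ B) ≈⟨ *S-assoc (partialInverse N) A (θ B) ⟨
        (partialInverse N *S A) *S θ B
          ≈⟨ *S-cong {partialInverse N *S A} {oneS S.- T} {θ B} {θ B}
               (partialInverse-*S N) (λ _ → refl) ⟩
        (oneS S.- T) *S θ B ≈⟨ S.distribʳ (θ B) oneS (S.- T) ⟩
        (oneS *S θ B) S.+ ((S.- T) *S θ B)
          ≈⟨ S.+-cong {oneS *S θ B} {θ B} {(S.- T) *S θ B} {S.- (T *S θ B)} (*S-identityˡ (θ B))
               (S.sym {S.- (T *S θ B)} {(S.- T) *S θ B} (SP.-‿distribˡ-* T (θ B))) ⟩
        θ B S.+ (S.- (T *S θ B)) ∎
      -- `U ^S N` has order N and θB adds one more, so the product has order N + 1 and vanishes at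
      -- n, whose degree is exactly N.
      high : - (T *S θ B) n ≈ 0#
      high = trans (-‿cong (trans (•-*S (sign N) (U ^S N) (θ B) n)
        (trans (*-congˡ (order-*S {N} {1} {U ^S N} {θ B} (order-^S order-U N) (order-θ order₁) n
                 (≡.subst (N <_) (ℕP.+-comm 1 N) (ℕP.n<1+n N)))) (zeroʳ _)))) -0#≈0#

    -- θ determines every coefficient of positive degree, by cancelling that degree. In degree zero
    -- both sides vanish: the logarithmic series starts with coefficient 0, and B has order 1.
    log-exp : logS A ≋ B
    log-exp n = cancel (totalDeg n) ≡.refl
      where
      cancel : ∀ d → totalDeg n ≡ d → logS A n ≈ B n
      cancel zero eq = trans (logS-partialLog n)
        (trans (reflexive (≡.cong (λ d → partialLog (suc d) n) eq))
        (trans (+-identityʳ _) (trans (*-congʳ logCoeff-zero)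
        (trans (zeroˡ _) (sym (order₁ n (s≤s (ℕP.≤-reflexive eq))))))))
      cancel (suc d) eq =
        ν-cancel d (≡.subst (λ d → ν d * logS A n ≈ ν d * B n) eq (θ-log n))

-- Counting subsets by size, with factorials in place of binomial coefficients.

module Binomial {c ℓ} (Λ : CommutativeRing c ℓ) (φ : ℚ → CommutativeRing.Carrier Λ)
                (hom : ContainsℚVia Λ φ) where
  open CommutativeRing Λ
  open FiniteSums Λ
  open Scalars Λ φ hom
  open CommutativeSemigroupProperties *-commutativeSemigroup using (x∙yz≈y∙xz; interchange)
  open SetoidReasoning setoid

  private
    e : ℕ → Carrier
    e k = φ (invFactℚ k)

  -- n + 1 is written as i + j inside the sum; the terms with i = 0 drop from the first half and
  -- those with j = 0 from the second.
  conv-ν : ∀ n (f : ℕ → ℕ → Carrier) →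
    ν (suc n) * conv (suc n) f
    ≈ conv n (λ i j → ν (suc i) * f (suc i) j) + conv n (λ i j → ν (suc j) * f i (suc j))
  conv-ν n f = begin
    ν (suc n) * conv (suc n) f
      ≈⟨ conv-*ˡ (suc n) _ f ⟨
    conv (suc n) (λ i j → ν (suc n) * f i j)
      ≈⟨ conv-cong (suc n) (λ i j p → trans (*-congʳ (trans (reflexive (≡.cong ν (≡.sym p))) (ν-+ i j)))
                                            (distribʳ (f i j) _ _)) ⟩
    conv (suc n) (λ i j → ν i * f i j + ν j * f i j)
      ≈⟨ conv-+ (suc n) (λ i j → ν i * f i j) (λ i j → ν j * f i j) ⟩
    conv (suc n) (λ i j → ν i * f i j) + conv (suc n) (λ i j → ν j * f i j)
      ≈⟨ +-cong (trans (+-congʳ (zeroˡ _)) (+-identityˡ _))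
                (trans (conv-last n (λ i j → ν j * f i j)) (trans (+-congˡ (zeroˡ _)) (+-identityʳ _))) ⟩
    conv n (λ i j → ν (suc i) * f (suc i) j) + conv n (λ i j → ν (suc j) * f i (suc j)) ∎

  -- There are n!/(i! j!) masks with i true and j false entries. Multiplying by the length and
  -- splitting on the first bit amounts to Pascal's rule. `h` varies in the induction because the
  -- first bit shifts one of its arguments.
  sum-allVec : ∀ xs (h : ℕ → ℕ → Carrier) →
    e (List.length xs) * sumOver (allVec (List.length xs))
      (λ m → h (List.length (selL xs m)) (List.length (selL xs (Vec.map not m))))
    ≈ conv (List.length xs) (λ i j → (e i * e j) * h i j)
  sum-allVec [] h = trans (*-congˡ (+-identityʳ _))
    (*-congʳ (sym (trans (*-congˡ invFact-zero) (*-identityʳ _))))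
  sum-allVec (x ∷ xs) h = ν-cancel n (begin
    ν (suc n) * (e (suc n) * sumOver (allVec (suc n)) g)
      ≈⟨ *-assoc _ _ _ ⟨
    (ν (suc n) * e (suc n)) * sumOver (allVec (suc n)) g
      ≈⟨ *-cong (trans (*-comm _ _) (invFact-suc n))
                (trans (sumOver-++ (List.map (true ∷_) (allVec n)) _ g)
                  (+-cong (sumOver-map (true ∷_) (allVec n) g) (sumOver-map (false ∷_) (allVec n) g))) ⟩
    e n * (sumOver (allVec n) (λ m → g (true ∷ m)) + sumOver (allVec n) (λ m → g (false ∷ m)))
      ≈⟨ distribˡ _ _ _ ⟩
    e n * sumOver (allVec n) (λ m → g (true ∷ m)) + e n * sumOver (allVec n) (λ m → g (false ∷ m))
      ≈⟨ +-cong (sum-allVec xs (λ i j → h (suc i) j)) (sum-allVec xs (λ i j → h i (suc j))) ⟩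
    conv n (λ i j → (e i * e j) * h (suc i) j) + conv n (λ i j → (e i * e j) * h i (suc j))
      ≈⟨ +-cong (conv-cong n (λ i j _ → absorbˡ i j _)) (conv-cong n (λ i j _ → absorbʳ i j _)) ⟩
    conv n (λ i j → ν (suc i) * ((e (suc i) * e j) * h (suc i) j))
      + conv n (λ i j → ν (suc j) * ((e i * e (suc j)) * h i (suc j)))
      ≈⟨ conv-ν n (λ i j → (e i * e j) * h i j) ⟨
    ν (suc n) * conv (suc n) (λ i j → (e i * e j) * h i j) ∎)
    where
    n = List.length xs
    g : Vec Bool (suc n) → Carrier
    g m = h (List.length (selL (x ∷ xs) m)) (List.length (selL (x ∷ xs) (Vec.map not m)))
    absorb : ∀ i → ν (suc i) * e (suc i) ≈ e i
    absorb i = trans (*-comm _ _) (invFact-suc i)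
    absorbˡ : ∀ i j y → (e i * e j) * y ≈ ν (suc i) * ((e (suc i) * e j) * y)
    absorbˡ i j y = trans (*-congʳ (trans (*-congʳ (sym (absorb i))) (*-assoc _ _ _))) (*-assoc _ _ _)
    absorbʳ : ∀ i j y → (e i * e j) * y ≈ ν (suc j) * ((e i * e (suc j)) * y)
    absorbʳ i j y = trans (*-congʳ (trans (*-congˡ (sym (absorb j))) (x∙yz≈y∙xz _ _ _))) (*-assoc _ _ _)

  invFactV : ∀ {r} → Vec ℕ r → Carrier
  invFactV {r} = PowerSeries.invFact Λ φ r

  -- The same count for several sorts, which are chosen independently of each other, so that the
  -- factorials multiply.
  sum-allSub : ∀ {r} (Ω : Obj r) (H : Vec ℕ r → Vec ℕ r → Carrier) →
    invFactV (sizes Ω) * sumOver (allSub Ω) (λ S → H (sizes (sel Ω S)) (sizes (sel Ω (cmp S))))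
    ≈ convV (sizes Ω) (λ a b → (invFactV a * invFactV b) * H a b)
  sum-allSub [] H = trans (*-congˡ (+-identityʳ _)) (*-congʳ (sym (*-identityˡ _)))
  sum-allSub (X ∷ Ω) H = begin
    (e n * I) * sumOver (allSub (X ∷ Ω)) _
      ≈⟨ *-congˡ (sumOver-cartesianProduct (allVec n) (allSub Ω) _) ⟩
    (e n * I) * sumOver (allVec n) (λ m → inner (l m) (l' m))
      ≈⟨ *-assoc _ _ _ ⟩
    e n * (I * sumOver (allVec n) (λ m → inner (l m) (l' m)))
      ≈⟨ *-congˡ (sumOver-*ˡ (allVec n) I _) ⟨
    e n * sumOver (allVec n) (λ m → I * inner (l m) (l' m))
      ≈⟨ *-congˡ (sumOver-cong (allVec n) (λ m → sum-allSub Ω (λ a b → H (l m ∷ a) (l' m ∷ b)))) ⟩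
    e n * sumOver (allVec n) (λ m → tail (l m) (l' m))
      ≈⟨ sum-allVec (elems X) tail ⟩
    conv n (λ i j → (e i * e j) * tail i j)
      ≈⟨ conv-cong n (λ i j _ → trans (sym (convV-*ˡ (sizes Ω) _ _))
           (convV-cong (sizes Ω) (λ a b _ → trans (sym (*-assoc _ _ _)) (*-congʳ (interchange _ _ _ _))))) ⟩
    convV (sizes (X ∷ Ω)) (λ a b → (invFactV a * invFactV b) * H a b) ∎
    where
    n = List.length (elems X)
    I = invFactV (sizes Ω)
    l l' : Vec Bool n → ℕ
    l m = List.length (selL (elems X) m)
    l' m = List.length (selL (elems X) (Vec.map not m))
    inner tail : ℕ → ℕ → Carrier
    inner i j = sumOver (allSub Ω) (λ S → H (i ∷ sizes (sel Ω S)) (j ∷ sizes (sel Ω (cmp S))))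
    tail i j = convV (sizes Ω) (λ a b → (invFactV a * invFactV b) * H (i ∷ a) (j ∷ b))

-- Weighted counting and the generating function identities.

module Enumeration {c ℓ} {r : ℕ} {Sp : Species r} (nonempty : Nonempty Sp) (E : CompOp Sp)
    (Λ : CommutativeRing c ℓ) (φ : ℚ → CommutativeRing.Carrier Λ) (hom : ContainsℚVia Λ φ)
    (W : Weight E Λ) where
  open Species Sp
  open CompOp E
  open CommutativeRing Λ
  open FiniteSums Λ
  open Scalars Λ φ hom
  open Binomial Λ φ hom
  open PowerSeries Λ φ r
  open SeriesRing Λ φ r
  open LogExp Λ φ hom r
  open Weight W
  open Splitting E
  open CommutativeSemigroupProperties *-commutativeSemigroup using (interchange)
  open SetoidReasoning setoid

  els : ∀ Ω → List (F Ω)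
  els Ω = elements (enum Ω)

  weightSum-els : ∀ Ω {P} (P? : ∀ x → Dec (P x)) →
    weightSum φ W Ω P P? ≈ sumOver (els Ω) (λ x → if ⌊ P? x ⌋ then w Ω x else 0#)
  weightSum-els Ω P? = sym (trans (sumOver-map (Inverse.to (enum Ω)) (List.allFin (size Ω)) _)
    (tabulate-sum (size Ω) (λ i → i) _))
    where
    tabulate-sum : ∀ n {A : Set} (g : Fin n → A) (f : A → Carrier) →
                   sumOver (List.tabulate g) f ≈ sumFin n (f ∘ g)
    tabulate-sum zero g f = refl
    tabulate-sum (suc n) g f = +-congˡ (tabulate-sum n (g ∘ Fin.suc) f)

  weightSum-filter : ∀ Ω {P} (P? : ∀ x → Dec (P x)) →
    weightSum φ W Ω P P? ≈ sumOver (List.filter P? (els Ω)) (w Ω)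
  weightSum-filter Ω P? = trans (weightSum-els Ω P?) (sumOver-filter P? (els Ω) (w Ω))

  weightSum-none : ∀ Ω {P} (P? : ∀ x → Dec (P x)) → (∀ x → ¬ P x) → weightSum φ W Ω P P? ≈ 0#
  weightSum-none Ω P? none = trans (weightSum-els Ω P?)
    (trans (sumOver-cong (els Ω) vanish) (sumOver-0 (els Ω)))
    where
    vanish : ∀ x → (if ⌊ P? x ⌋ then w Ω x else 0#) ≈ 0#
    vanish x with P? x
    ... | yes p = ⊥-elim (none x p)
    ... | no _ = refl

  -- Transport is a bijection and (W1) makes it preserve weights. Totals over parts of an object
  -- thus depend only on sizes and can be read as coefficients of generating functions.
  weightSum-iso : ∀ {Ω Ω'} (f : Iso Ω Ω') {P P'} (P? : ∀ x → Dec (P x)) (P'? : ∀ y → Dec (P' y)) →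
    (∀ x → P x → P' (transport f x)) → (∀ y → P' y → P (transport (iso-sym f) y)) →
    weightSum φ W Ω P P? ≈ weightSum φ W Ω' P' P'?
  weightSum-iso {Ω} {Ω'} f P? P'? fwd bwd = begin
    weightSum φ W Ω _ P?
      ≈⟨ weightSum-filter Ω P? ⟩
    sumOver xs (w Ω)
      ≈⟨ sumOver-cong xs (λ x → W1 (iso-mor f) x) ⟨
    sumOver xs (w Ω' ∘ transport f)
      ≈⟨ sumOver-map (transport f) xs (w Ω') ⟨
    sumOver (List.map (transport f) xs) (w Ω')
      ≈⟨ sumOver-↭ (w Ω') (unique-↭
           (Unique.map⁺ (transport-injective f) (Unique.filter⁺ P? (elements-unique (enum Ω))))
           (Unique.filter⁺ P'? (elements-unique (enum Ω'))) into' onto') ⟩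
    sumOver (List.filter P'? (els Ω')) (w Ω')
      ≈⟨ weightSum-filter Ω' P'? ⟨
    weightSum φ W Ω' _ P'? ∎
    where
    xs = List.filter P? (els Ω)
    into' : ∀ {y} → y ∈ List.map (transport f) xs → y ∈ List.filter P'? (els Ω')
    into' y∈ with x , x∈ , ≡.refl ← ∈-map⁻ (transport f) y∈ =
      ∈-filter⁺ P'? (∈-elements (enum Ω') _) (fwd x (proj₂ (∈-filter⁻ P? {xs = els Ω} x∈)))
    onto' : ∀ {y} → y ∈ List.filter P'? (els Ω') → y ∈ List.map (transport f) xs
    onto' {y} y∈ = ≡.subst (_∈ List.map (transport f) xs) (transport-inverse (iso-sym f) y)
      (∈-map⁺ (transport f) (∈-filter⁺ P? (∈-elements (enum Ω) _)
        (bwd y (proj₂ (∈-filter⁻ P'? {xs = els Ω'} y∈)))))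

  total-η : Obj r → Carrier
  total-η Ω = weightSum φ W Ω (InFη E Ω) (inFη? E Ω)

  total-k : ℕ → Obj r → Carrier
  total-k k Ω = weightSum φ W Ω (InFk E k Ω) (inFk? E k Ω)

  std-iso : ∀ (Ω : Obj r) → Iso Ω (stdObj (sizes Ω))
  std-iso Ω = sameSizes⇒iso (≡.sym (sizes-stdObj (sizes Ω)))

  total-η-std : ∀ Ω → total-η Ω ≈ total-η (stdObj (sizes Ω))
  total-η-std Ω = weightSum-iso (std-iso Ω) (inFη? E Ω) (inFη? E _)
    (InFη-transport (std-iso Ω)) (InFη-transport (iso-sym (std-iso Ω)))

  total-k-std : ∀ k Ω → total-k k Ω ≈ total-k k (stdObj (sizes Ω))
  total-k-std k Ω = weightSum-iso (std-iso Ω) (inFk? E k Ω) (inFk? E k _)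
    (InFk-transport k (std-iso Ω)) (InFk-transport k (iso-sym (std-iso Ω)))

  -- The condition defining `InFk (suc k)` with the piece `S` peeled first held fixed, so that pairs
  -- of a structure and a piece can be counted in two ways.
  Peels : ℕ → ∀ Ω → Sub Ω → F Ω → Set
  Peels k Ω S x = ∃ λ a → ∃ λ b →
    InFη E (sel Ω S) a × InFk E k (sel Ω (cmp S)) b × η Ω S a b ≡ x

  peels? : ∀ k Ω S x → Dec (Peels k Ω S x)
  peels? k Ω S x = ∃Fin? (enum _) _ λ a → ∃Fin? (enum _) _ λ b →
    inFη? E (sel Ω S) a ×-dec (inFk? E k (sel Ω (cmp S)) b ×-dec decEqFin (enum Ω) (η Ω S a b) x)

  -- η over `S` is injective, and its image on these pairs is exactly the set of x that can be
  -- peeled along `S`.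
  total-product : ∀ k Ω S → total-η (sel Ω S) * total-k k (sel Ω (cmp S))
    ≈ sumOver (els Ω) (λ x → if ⌊ peels? k Ω S x ⌋ then w Ω x else 0#)
  total-product k Ω S = begin
    total-η (sel Ω S) * total-k k (sel Ω (cmp S))
      ≈⟨ *-cong (weightSum-filter _ (inFη? E (sel Ω S))) (weightSum-filter _ (inFk? E k (sel Ω (cmp S)))) ⟩
    sumOver as (w (sel Ω S)) * sumOver bs (w (sel Ω (cmp S)))
      ≈⟨ sumOver-*ʳ as _ _ ⟨
    sumOver as (λ a → w (sel Ω S) a * sumOver bs (w (sel Ω (cmp S))))
      ≈⟨ sumOver-cong as (λ a → sumOver-*ˡ bs _ _) ⟨
    sumOver as (λ a → sumOver bs (λ b → w (sel Ω S) a * w (sel Ω (cmp S)) b))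
      -- (W2) asks for a left factor in F_η, which membership in the filtered list supplies.
      ≈⟨ sumOver-cong-∈ as (λ a a∈ → sumOver-cong bs (λ b →
           W2 Ω S a b (proj₂ (∈-filter⁻ (inFη? E (sel Ω S)) {xs = els (sel Ω S)} a∈)))) ⟨
    sumOver as (λ a → sumOver bs (λ b → w Ω (η Ω S a b)))
      ≈⟨ sumOver-cartesianProduct as bs _ ⟨
    sumOver (List.cartesianProduct as bs) (w Ω ∘ pair)
      ≈⟨ sumOver-map pair (List.cartesianProduct as bs) (w Ω) ⟨
    sumOver (List.map pair (List.cartesianProduct as bs)) (w Ω)
      ≈⟨ sumOver-↭ (w Ω) (unique-↭
           (Unique.map⁺ pair-injective (Unique.cartesianProduct⁺
             (Unique.filter⁺ (inFη? E (sel Ω S)) (elements-unique (enum (sel Ω S))))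
             (Unique.filter⁺ (inFk? E k (sel Ω (cmp S))) (elements-unique (enum (sel Ω (cmp S)))))))
           (Unique.filter⁺ (peels? k Ω S) (elements-unique (enum Ω))) into' onto') ⟩
    sumOver (List.filter (peels? k Ω S) (els Ω)) (w Ω)
      ≈⟨ sumOver-filter (peels? k Ω S) (els Ω) (w Ω) ⟨
    sumOver (els Ω) (λ x → if ⌊ peels? k Ω S x ⌋ then w Ω x else 0#) ∎
    where
    as = List.filter (inFη? E (sel Ω S)) (els (sel Ω S))
    bs = List.filter (inFk? E k (sel Ω (cmp S))) (els (sel Ω (cmp S)))
    pair : F (sel Ω S) × F (sel Ω (cmp S)) → F Ω
    pair (a , b) = η Ω S a b
    pair-injective : ∀ {p q} → pair p ≡ pair q → p ≡ q
    pair-injective eq with ≡.refl , ≡.refl ← η-injective Ω S _ _ _ _ eq = ≡.refl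
    into' : ∀ {x} → x ∈ List.map pair (List.cartesianProduct as bs) →
            x ∈ List.filter (peels? k Ω S) (els Ω)
    into' x∈ with (a , b) , ab∈ , ≡.refl ← ∈-map⁻ pair x∈
      with a∈ , b∈ ← ∈-cartesianProduct⁻ as bs ab∈ =
      ∈-filter⁺ (peels? k Ω S) (∈-elements (enum Ω) _)
        (a , b , proj₂ (∈-filter⁻ (inFη? E (sel Ω S)) {xs = els (sel Ω S)} a∈)
               , proj₂ (∈-filter⁻ (inFk? E k (sel Ω (cmp S))) {xs = els (sel Ω (cmp S))} b∈) , ≡.refl)
    onto' : ∀ {x} → x ∈ List.filter (peels? k Ω S) (els Ω) →
            x ∈ List.map pair (List.cartesianProduct as bs)
    onto' x∈ with a , b , a∈ , b∈ , ≡.refl ← proj₂ (∈-filter⁻ (peels? k Ω S) {xs = els Ω} x∈) =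
      ∈-map⁺ pair (∈-cartesianProduct⁺
        (∈-filter⁺ (inFη? E (sel Ω S)) (∈-elements (enum (sel Ω S)) a) a∈)
        (∈-filter⁺ (inFk? E k (sel Ω (cmp S))) (∈-elements (enum (sel Ω (cmp S))) b) b∈))

  -- For x in F^(k+1) the pieces that can be peeled first are all the atoms: `InFk-η⁻` shows that
  -- the rest then lies in F^(k).
  peels-count : ∀ k Ω x → InFk E (suc k) Ω x →
    List.length (List.filter (λ S → peels? k Ω S x) (allSub Ω)) ≡ suc k
  peels-count k Ω x x∈ = ≡.trans
    (↭-length (unique-↭ (Unique.filter⁺ (λ S → peels? k Ω S x) (allSub-unique Ω))
                        (Unique.filter⁺ (atom? nonempty Ω x) (allSub-unique Ω)) into' onto'))
    (InFk⇒atomCount nonempty (suc k) Ω x x∈)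
    where
    into' : ∀ {S} → S ∈ List.filter (λ S → peels? k Ω S x) (allSub Ω) → S ∈ atoms nonempty Ω x
    into' {S} S∈ with a , b , a∈ , _ , eq ← proj₂ (∈-filter⁻ (λ S → peels? k Ω S x) {xs = allSub Ω} S∈) =
      ∈-filter⁺ (atom? nonempty Ω x) (∈-allSub Ω S) (a , b , a∈ , eq)
    onto' : ∀ {S} → S ∈ atoms nonempty Ω x → S ∈ List.filter (λ S → peels? k Ω S x) (allSub Ω)
    onto' {S} S∈ with a , b , a∈ , ≡.refl ← proj₂ (∈-filter⁻ (atom? nonempty Ω x) {xs = allSub Ω} S∈) =
      ∈-filter⁺ (λ S → peels? k Ω S x) (∈-allSub Ω S)
        (a , b , a∈ , InFk-η⁻ nonempty k Ω S a b a∈ x∈ , ≡.refl)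

  sumOver-const : ∀ {A : Set} (xs : List A) y → sumOver xs (λ _ → y) ≈ ν (List.length xs) * y
  sumOver-const [] y = sym (zeroˡ y)
  sumOver-const (_ ∷ xs) y =
    trans (+-cong (sym (*-identityˡ y)) (sumOver-const xs y)) (sym (distribʳ y _ _))

  peels-sum : ∀ k Ω x →
    sumOver (allSub Ω) (λ S → if ⌊ peels? k Ω S x ⌋ then w Ω x else 0#)
    ≈ ν (suc k) * (if ⌊ inFk? E (suc k) Ω x ⌋ then w Ω x else 0#)
  peels-sum k Ω x = trans (sumOver-filter (λ S → peels? k Ω S x) (allSub Ω) (λ _ → w Ω x))
    (trans (sumOver-const (List.filter (λ S → peels? k Ω S x) (allSub Ω)) (w Ω x))
           (count (inFk? E (suc k) Ω x)))
    where
    count : (d : Dec (InFk E (suc k) Ω x)) →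
      ν (List.length (List.filter (λ S → peels? k Ω S x) (allSub Ω))) * w Ω x
      ≈ ν (suc k) * (if ⌊ d ⌋ then w Ω x else 0#)
    count (yes x∈) = *-congʳ (reflexive (≡.cong ν (peels-count k Ω x x∈)))
    count (no x∉) with List.filter (λ S → peels? k Ω S x) (allSub Ω) in eq
    ... | [] = trans (zeroˡ _) (sym (zeroʳ _))
    -- A single piece along which x peels would already place x in F^(k+1).
    ... | S ∷ _ = ⊥-elim (x∉ (S , proj₂ (∈-filter⁻ (λ S → peels? k Ω S x) {v = S} {xs = allSub Ω}
                                (≡.subst (S ∈_) (≡.sym eq) (here ≡.refl)))))

  -- Each x in F^(k+1) is counted once for each of its k+1 atoms.
  total-k-suc : ∀ k Ω → ν (suc k) * total-k (suc k) Ω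
    ≈ sumOver (allSub Ω) (λ S → total-η (sel Ω S) * total-k k (sel Ω (cmp S)))
  total-k-suc k Ω = sym (begin
    sumOver (allSub Ω) (λ S → total-η (sel Ω S) * total-k k (sel Ω (cmp S)))
      ≈⟨ sumOver-cong (allSub Ω) (total-product k Ω) ⟩
    sumOver (allSub Ω) (λ S → sumOver (els Ω) (λ x → if ⌊ peels? k Ω S x ⌋ then w Ω x else 0#))
      ≈⟨ sumOver-swap (allSub Ω) (els Ω) _ ⟩
    sumOver (els Ω) (λ x → sumOver (allSub Ω) (λ S → if ⌊ peels? k Ω S x ⌋ then w Ω x else 0#))
      ≈⟨ sumOver-cong (els Ω) (peels-sum k Ω) ⟩
    sumOver (els Ω) (λ x → ν (suc k) * (if ⌊ inFk? E (suc k) Ω x ⌋ then w Ω x else 0#))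
      ≈⟨ sumOver-*ˡ (els Ω) _ _ ⟩
    ν (suc k) * sumOver (els Ω) (λ x → if ⌊ inFk? E (suc k) Ω x ⌋ then w Ω x else 0#)
      ≈⟨ *-congˡ (weightSum-els Ω (inFk? E (suc k) Ω)) ⟨
    ν (suc k) * total-k (suc k) Ω ∎)

  -- Totals depend only on sizes, so grouping the subsets of `total-k-suc` by size distributes the
  -- factorial of n over the two parts and produces the Cauchy product.
  GF~-suc : ∀ k n → ν (suc k) * GF~ φ W n (suc k) ≈ (GFη φ W *S (λ m → GF~ φ W m k)) n
  GF~-suc k n = begin
    ν (suc k) * (total-k (suc k) Ω * invFact n)
      ≈⟨ *-assoc _ _ _ ⟨
    (ν (suc k) * total-k (suc k) Ω) * invFact n
      ≈⟨ *-comm _ _ ⟩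
    invFact n * (ν (suc k) * total-k (suc k) Ω)
      ≈⟨ *-congˡ (trans (total-k-suc k Ω) (sumOver-cong (allSub Ω) (λ S →
           *-cong (total-η-std (sel Ω S)) (total-k-std k (sel Ω (cmp S)))))) ⟩
    invFact n * sumOver (allSub Ω) (λ S → H (sizes (sel Ω S)) (sizes (sel Ω (cmp S))))
      ≈⟨ ≡.subst (λ v → invFact v * sumOver (allSub Ω) (λ S → H (sizes (sel Ω S)) (sizes (sel Ω (cmp S))))
                        ≈ convV v (λ a b → (invFact a * invFact b) * H a b))
                 (sizes-stdObj n) (sum-allSub Ω H) ⟩
    convV n (λ a b → (invFact a * invFact b) * H a b)
      ≈⟨ convV-cong n (λ a b _ → trans (*-comm _ _) (interchange _ _ _ _)) ⟩
    convV n (λ a b → GFη φ W a * GF~ φ W b k)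
      ≈⟨ *S-conv (GFη φ W) (λ m → GF~ φ W m k) n ⟨
    (GFη φ W *S (λ m → GF~ φ W m k)) n ∎
    where
    Ω = stdObj n
    H : Vec ℕ r → Vec ℕ r → Carrier
    H a b = total-η (stdObj a) * total-k k (stdObj b)

  GF~-zero : ∀ n → GF~ φ W n 0 ≈ oneS n
  GF~-zero n with isZeroIdx n in eq
  ... | false = trans (*-congʳ (weightSum-none (stdObj n) (inFk? E 0 (stdObj n))
                  (λ _ e → absurd (≡.trans (≡.sym eq) (≡.trans (≡.sym (isEmptyObj-stdObj n)) e)))))
                  (zeroˡ _)
    where
    absurd : false ≡ true → ⊥
    absurd ()
  ... | true = trans (*-cong weight-one (invFact-zeroIdx n eq)) (*-identityˡ _)
    where
    empty-obj : isEmptyObj (stdObj n) ≡ true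
    empty-obj = ≡.trans (isEmptyObj-stdObj n) eq
    empty : IsEmpty (stdObj n)
    empty = isEmptyObj-true⁻ (stdObj n) empty-obj
    x = F-empty nonempty (stdObj n) empty
    weight-one : total-k 0 (stdObj n) ≈ 1#
    weight-one = trans (weightSum-filter (stdObj n) (inFk? E 0 (stdObj n)))
      (trans (sumOver-↭ (w (stdObj n)) (unique-↭
               (Unique.filter⁺ (inFk? E 0 (stdObj n)) (elements-unique (enum (stdObj n))))
               ([] ∷ []) (λ {y} _ → here (F-empty-unique nonempty (stdObj n) empty y x))
               (λ _ → ∈-filter⁺ (inFk? E 0 (stdObj n)) (∈-elements (enum (stdObj n)) _) empty-obj)))
      -- (W0) speaks of `∅obj r`; (W1) carries the weight there along the empty bijection.
      (trans (+-identityʳ _) (trans (sym (W1 (iso-mor f) x)) (W0 _))))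
      where
      f : Iso (stdObj n) (∅obj r)
      f = isEmpty⇒iso empty (isEmptyObj-true⁻ (∅obj r) (∅obj-empty r))
    invFact-zeroIdx : ∀ {s} (m : Vec ℕ s) → isZeroIdx m ≡ true → invFactV m ≈ 1#
    invFact-zeroIdx [] _ = refl
    invFact-zeroIdx (zero ∷ m) e =
      trans (*-cong invFact-zero (invFact-zeroIdx m e)) (*-identityˡ _)

  card-stdObj : ∀ (n : Vec ℕ r) → card (stdObj n) ≡ totalDeg n
  card-stdObj n = ≡.cong totalDeg (sizes-stdObj n)

  GFη-order : Order 1 (GFη φ W)
  GFη-order n n< = trans (*-congʳ (weightSum-none (stdObj n) (inFη? E (stdObj n))
    (λ _ (ne , _) → ℕP.<⇒≱ n< (≡.subst (1 ≤_) (card-stdObj n) (card-positive (stdObj n) ne)))))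
    (zeroˡ _)

  -- Each x lies in F^(k) for exactly one k, its number of atoms, and this number is at most |n|,
  -- hence below N.
  GF-sum : ∀ N n → totalDeg n < N → GF φ W n ≈ sumTo N (GF~ φ W n)
  GF-sum N n n< = begin
    weightSum φ W Ω (λ _ → ⊤) (λ _ → yes tt) * invFact n
      ≈⟨ *-congʳ (weightSum-els Ω (λ _ → yes tt)) ⟩
    sumOver (els Ω) (w Ω) * invFact n
      ≈⟨ *-congʳ (sumOver-cong (els Ω) split) ⟩
    sumOver (els Ω) (λ x → sumTo N (part x)) * invFact n
      ≈⟨ *-congʳ (sumOver-sumTo-swap (els Ω) N part) ⟩
    sumTo N (λ k → sumOver (els Ω) (λ x → part x k)) * invFact n
      ≈⟨ sumTo-*ʳ N (invFact n) _ ⟨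
    sumTo N (λ k → sumOver (els Ω) (λ x → part x k) * invFact n)
      ≈⟨ sumTo-cong N (λ k → *-congʳ (weightSum-els Ω (inFk? E k Ω))) ⟨
    sumTo N (GF~ φ W n) ∎
    where
    Ω = stdObj n
    part : F Ω → ℕ → Carrier
    part x k = if ⌊ inFk? E k Ω x ⌋ then w Ω x else 0#
    part-off : ∀ x k → k ≢ atomCount nonempty Ω x → part x k ≈ 0#
    part-off x k k≢ with inFk? E k Ω x
    ... | yes x∈ = ⊥-elim (k≢ (≡.sym (InFk⇒atomCount nonempty k Ω x x∈)))
    ... | no _ = refl
    member : ∀ x → InFk E (atomCount nonempty Ω x) Ω x
    member x = atomCount⇒InFk nonempty _ Ω x ≡.refl
    part-on : ∀ x → part x (atomCount nonempty Ω x) ≈ w Ω x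
    part-on x with inFk? E (atomCount nonempty Ω x) Ω x
    ... | yes _ = refl
    ... | no x∉ = ⊥-elim (x∉ (member x))
    split : ∀ x → w Ω x ≈ sumTo N (part x)
    split x = sym (trans (sumTo-single N (part x) (atomCount nonempty Ω x)
      (ℕP.≤-<-trans (≡.subst (atomCount nonempty Ω x ≤_) (card-stdObj n)
                      (InFk-card _ Ω x (member x))) n<) (part-off x)) (part-on x))

  GF~-exp : ∀ k n → GF~ φ W n k ≈ expY (GFη φ W) n k
  GF~-exp zero n = trans (GF~-zero n) (sym (trans (*-congʳ invFact-zero) (*-identityˡ _)))
  GF~-exp (suc k) n = ν-cancel k (begin
    ν (suc k) * GF~ φ W n (suc k)
      ≈⟨ GF~-suc k n ⟩
    (B *S (λ m → GF~ φ W m k)) n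
      ≈⟨ *S-cong {B} {B} {λ m → GF~ φ W m k} {e k • (B ^S k)} (λ _ → refl) (GF~-exp k) n ⟩
    (B *S (e k • (B ^S k))) n
      ≈⟨ *S-• (e k) B (B ^S k) n ⟩
    e k * (B ^S suc k) n
      ≈⟨ *-congʳ (trans (*-comm _ _) (invFact-suc k)) ⟨
    (ν (suc k) * e (suc k)) * (B ^S suc k) n
      ≈⟨ *-assoc _ _ _ ⟩
    ν (suc k) * (e (suc k) * (B ^S suc k) n) ∎)
    where
    B = GFη φ W

  GF-isExp : IsExp (GFη φ W) (GF φ W)
  GF-isExp = record
    { order₁ = GFη-order
    ; expand = λ N n n< → trans (GF-sum N n n<) (sumTo-cong N (λ k → GF~-exp k n)) }

  ^S-cong : ∀ {A B} → A ≋ B → ∀ k → (A ^S k) ≋ (B ^S k)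
  ^S-cong e zero n = refl
  ^S-cong {A} {B} e (suc k) = *S-cong {A} {B} {A ^S k} {B ^S k} e (^S-cong e k)

  GF~-pow : ∀ k n → GF~ φ W n k ≈ powY (GF φ W) n k
  GF~-pow k n = trans (GF~-exp k n) (*-congˡ (sym (^S-cong (log-exp GF-isExp) k n)))

theorem2p4 : ∀ {c ℓ} (r : ℕ) → 1 ≤ r →
    (Sp : Species r) → Nonempty Sp → (E : CompOp Sp) →
    (Λ : CommutativeRing c ℓ) (φ : ℚ → CommutativeRing.Carrier Λ) → ContainsℚVia Λ φ →
    (W : Weight E Λ) →
    PowerSeries._≈S₂_ Λ φ r (GF~ φ W) (PowerSeries.expY Λ φ r (GFη φ W))
    × PowerSeries._≈S₂_ Λ φ r (GF~ φ W) (PowerSeries.powY Λ φ r (GF φ W))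
theorem2p4 r _ Sp nonempty E Λ φ hom W = (λ n k → GF~-exp k n) , (λ n k → GF~-pow k n)
  where open Enumeration nonempty E Λ φ hom W
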